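{- Let $n > k > t > j \geq 1$ be integers and let $\mathcal F \subset \binom{[n]}{k}$ be a $t$-intersecting family with $$|\mathcal F| \geq \binom{2k-t}{k}\left(1 + \frac{t-j}{k+t+1-j}\right).$$ Then $$\frac{|\partial^j \mathcal F|}{|\mathcal F|} \geq \frac{\binom{2(k-1)-t}{k-1-j}}{\binom{2(k-1)-t}{k-1}}.$$
   Context: $[n]=\{1,\dots,n\}$, and $\binom{[n]}{k}$ is the collection of all $k$-element subsets of $[n]$. A family $\mathcal F \subset \binom{[n]}{k}$ is $t$-intersecting if $|F\cap F'|\ge t$ for all $F,F'\in\mathcal F$. The $j$'th shadow is $\partial^j\mathcal F=\{G\in\binom{[n]}{k-j} : \exists F\in\mathcal F,\ G\subset F\}$. -}

module Defs where

open import Data.Fin.Subset using (Subset; Side; inside; outside; ∣_∣; _∩_; _⊆_)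
open import Data.Fin.Subset.Properties using (_⊆?_)
open import Data.Integer.Base using (+_)
open import Data.List.Base using (List; []; _∷_; length; filter; cartesianProductWith)
open import Data.List.Membership.Propositional using (_∈_)
open import Data.List.Membership.Propositional.Properties
  using (∈-cartesianProductWith⁺)
open import Data.List.Relation.Unary.All as All using (All; []; _∷_)
open import Data.List.Relation.Unary.All.Properties using (all-filter)
open import Data.List.Relation.Unary.AllPairs using ([]; _∷_)
open import Data.List.Relation.Unary.Any using (Any; any?; here; there)
open import Data.List.Relation.Unary.Unique.Propositional using (Unique)
open import Data.List.Relation.Unary.Unique.Propositional.Properties
  using (filter⁺; cartesianProductWith⁺)
open import Data.Nat.Base hiding (_/_)
open import Data.Nat.Combinatorics using (_C_; nCk+nC[k+1]≡[n+1]C[k+1])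
open import Data.Nat.Properties
open import Data.Product.Base using (_×_; proj₁)
import Data.Rational.Base as ℚ
import Data.Rational.Properties as ℚ
open import Data.Rational.Base using (ℚ; 1ℚ; _/_)
open import Data.Vec.Base as Vec using ()
open import Data.Vec.Properties using (∷-injective)
open import Relation.Binary.PropositionalEquality using (_≡_; refl; subst)
open import Relation.Nullary.Decidable using (Dec; _×-dec_)

private
  variable
    n k t j m : ℕ

sides : List Side
sides = outside ∷ inside ∷ []

allSubsets : ∀ n → List (Subset n)
allSubsets zero    = Vec.[] ∷ []
allSubsets (suc n) = cartesianProductWith Vec._∷_ sides (allSubsets n)

∈-sides : (s : Side) → s ∈ sides
∈-sides outside = here refl
∈-sides inside  = there (here refl)

∈-allSubsets : (G : Subset n) → G ∈ allSubsets n
∈-allSubsets Vec.[]      = here refl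
∈-allSubsets (s Vec.∷ G) = ∈-cartesianProductWith⁺ Vec._∷_ (∈-sides s) (∈-allSubsets G)

allSubsets-unique : ∀ n → Unique (allSubsets n)
allSubsets-unique zero    = [] ∷ []
allSubsets-unique (suc n) =
  cartesianProductWith⁺ Vec._∷_ ∷-injective
    (((λ ()) ∷ []) ∷ [] ∷ []) (allSubsets-unique n)

-- The ground set [n] is represented by Fin n, and a family of k-element
-- subsets of [n] by a repetition-free list, so its cardinality is the length.
record Family (n k : ℕ) : Set where
  field
    members : List (Subset n)
    unique  : Unique members
    uniform : All (λ F → ∣ F ∣ ≡ k) members

open Family public

#_ : Family n k → ℕ
# 𝓕 = length (members 𝓕)

infix 9 #_

Intersecting : ℕ → Family n k → Set
Intersecting t 𝓕 = ∀ {F F′} → F ∈ members 𝓕 → F′ ∈ members 𝓕 → t ≤ ∣ F ∩ F′ ∣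

-- Subtraction k ∸ j is truncated, so this is the j'th shadow only when j ≤ k.
∂ : (j : ℕ) → Family n k → Family n (k ∸ j)
∂ {n} {k} j 𝓕 = record
  { members = filter inShadow? (allSubsets n)
  ; unique  = filter⁺ inShadow? (allSubsets-unique n)
  ; uniform = All.map proj₁ (all-filter inShadow? (allSubsets n))
  }
  where
  inShadow? : (G : Subset n) → Dec (∣ G ∣ ≡ k ∸ j × Any (G ⊆_) (members 𝓕))
  inShadow? G = (∣ G ∣ ≟ k ∸ j) ×-dec any? (G ⊆?_) (members 𝓕)

fromℕ : ℕ → ℚ
fromℕ m = + m / 1

-- The lemmas below show that the denominators in the theorem are nonzero under
-- its hypotheses, so that its quotients are genuine divisions in ℚ.
C-nonZero : k ≤ n → NonZero (n C k)
C-nonZero {k} {n} k≤n = >-nonZero (C-positive n k k≤n)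
  where
  C-positive : ∀ n k → k ≤ n → 0 < n C k
  C-positive n       zero    _         = s≤s z≤n
  C-positive (suc n) (suc k) (s≤s k≤n) =
    subst (0 <_) (nCk+nC[k+1]≡[n+1]C[k+1] n k)
      (<-≤-trans (C-positive n k k≤n) (m≤m+n _ _))

fromℕ-nonZero : .{{ℚ.Positive (fromℕ m)}} → NonZero m
fromℕ-nonZero {suc m} = _

k≤2k∸t : k > t → k ≤ 2 * k ∸ t
k≤2k∸t {k} {t} k>t = m+n≤o⇒m≤o∸n k (+-monoʳ-≤ k (≤-trans (<⇒≤ k>t) (m≤m+n k 0)))

k∸1≤2[k∸1]∸t : k > t → k ∸ 1 ≤ 2 * (k ∸ 1) ∸ t
k∸1≤2[k∸1]∸t {suc k} (s≤s t≤k) =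
  m+n≤o⇒m≤o∸n k (+-monoʳ-≤ k (≤-trans t≤k (m≤m+n k 0)))

k+t+1∸j-nonZero : ∀ k → t > j → NonZero (k + t + 1 ∸ j)
k+t+1∸j-nonZero {t} k t>j =
  >-nonZero (m<n⇒0<n∸m (<-≤-trans t>j (≤-trans (m≤n+m t k) (m≤m+n (k + t) 1))))

#-nonZero : (𝓕 : Family n k) (k>t : k > t) (t>j : t > j) →
  let instance _ = k+t+1∸j-nonZero k t>j in
  fromℕ (# 𝓕) ℚ.≥ fromℕ ((2 * k ∸ t) C k) ℚ.* (1ℚ ℚ.+ + (t ∸ j) / (k + t + 1 ∸ j)) →
  NonZero (# 𝓕)
#-nonZero {k = k} {t} {j} 𝓕 k>t t>j large =
  fromℕ-nonZero {{ℚ.positive (ℚ.<-≤-trans (ℚ.positive⁻¹ _ {{bound-pos}}) large)}}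
  where
  instance
    _ = k+t+1∸j-nonZero k t>j
    _ = C-nonZero (k≤2k∸t k>t)
    C-pos = ℚ.normalize-pos ((2 * k ∸ t) C k) 1
    frac-nonNeg = ℚ.normalize-nonNeg (t ∸ j) (k + t + 1 ∸ j)
  sum-pos = ℚ.pos+nonNeg⇒pos 1ℚ (+ (t ∸ j) / (k + t + 1 ∸ j))
  bound-pos = ℚ.pos*pos⇒pos (fromℕ ((2 * k ∸ t) C k)) {{C-pos}} _ {{sum-pos}}

{-# OPTIONS --safe #-}
module Submission where

-- By shifting, the family may be assumed left-compressed, and then any two members
-- F, K satisfy |F ∩ [l]| + |K ∩ [l]| ≥ l + t for some l.  Put s = k − 1 − t.  If
-- every member F has an l with |F ∩ [l]| ≥ (l + t) / 2 and |[l] \ F| ≤ s, then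
-- cutting each F at the last such l and applying the local LYM inequality to the
-- parts inside [l] gives the ratio of the family of all (k − 1)-subsets of
-- [2k − 2 − t], as in Katona's theorem with k − 1 in place of k.
--
-- Otherwise some K stays below this line until l = 2k − t.  Then every F not inside
-- [2k − t] reaches the next line (l + t + 1) / 2, which multiplies the ratio for
-- these F by at least 1 + j / s.  The members inside [2k − t], f in number, lose
-- only a fraction j (t − j) / ((k − j) (k − t + j)).  If some K even stays below
-- (l + t − 1) / 2, the next line is (l + t + 2) / 2, the gain is at least 2 j / s,
-- and f ≤ C(2k − t, k) suffices.  If not, then a reflection-type bound gives
-- f ≤ C(2k − 2 − t, k) + 3 C(2k − 2 − t, k − 1), so that by the assumption on the
-- size of the family there are enough members outside [2k − t].
open import Defs
open import Data.Bool.Base using (Bool; true; false; T; _∧_; _∨_)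
import Data.Bool.Properties as Bool
open import Data.Bool.Properties using (T?; T-∧; T-∨)
open import Data.Empty using (⊥-elim)
open import Data.Fin.Base using (Fin; zero; suc)
import Data.Fin.Properties as Fin
open import Data.Fin.Subset using (Subset; inside; outside; ∣_∣; _∩_; _⊆_)
open import Data.Fin.Subset.Properties
  using (_⊆?_; anySubset?; ∩-comm; drop-∷-⊆; ∣p∣≤n; out⊆; s⊆s; ⊆-refl; ⊆-trans)
import Data.Integer.Base as ℤ
import Data.Integer.Properties as ℤ
open import Data.List.Base using (List; []; _∷_; length)
open import Data.List.Membership.DecPropositional using () renaming (_∈?_ to member?)
open import Data.List.Membership.Propositional using (_∈_; lose)
open import Data.List.Membership.Propositional.Properties using (∈-filter⁺)
import Data.List.Relation.Unary.All as All
open import Data.List.Relation.Unary.AllPairs using ([]; _∷_)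
open import Data.List.Relation.Unary.Unique.Propositional using (Unique)
open import Data.Nat.Base hiding (_/_)
open import Data.Nat.Combinatorics
  using (_C_; nCk≡n!/k![n-k]!; k![n∸k]!∣n!; k>n⇒nCk≡0; nCk≡nC[n∸k]; nCk+nC[k+1]≡[n+1]C[k+1])
open import Data.Nat.DivMod using (m/n*n≡m)
open import Data.Nat.Induction using (<-wellFounded)
open import Data.Nat.Properties
open import Data.Nat.Tactic.RingSolver using (solve-∀)
open import Data.Product.Base using (∃; ∃₂; _×_; _,_)
open import Data.Rational.Base as ℚ using (1ℚ; _/_; toℚᵘ)
import Data.Rational.Properties as ℚ
open import Data.Rational.Unnormalised.Base as ℚᵘ using (mkℚᵘ; *≤*; 1ℚᵘ)
import Data.Rational.Unnormalised.Properties as ℚᵘ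
open import Data.Sum.Base using (_⊎_; inj₁; inj₂)
open import Data.Unit.Base using (tt)
open import Data.Vec.Base using ([]; _∷_; here; there; _[_]=_)
open import Data.Vec.Properties using (≡-dec)
open import Function.Base using (_∘_)
open import Function.Bundles using (Equivalence)
open import Induction.WellFounded using (Acc; acc)
open import Relation.Binary.Definitions using (DecidableEquality; tri<; tri≈; tri>)
open import Relation.Binary.PropositionalEquality
open import Relation.Nullary using (¬_; Dec; yes; no; contradiction)
open import Relation.Nullary.Decidable
  using (⌊_⌋; _×-dec_; ¬?; decidable-stable; toWitness; fromWitness)

private
  variable
    n : ℕ

-- Sums and counts over all subsets of [n]

∑ : (Subset n → ℕ) → ℕ
∑ {zero}  g = g []
∑ {suc n} g = ∑ (g ∘ (outside ∷_)) + ∑ (g ∘ (inside ∷_))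

∑-mono : {g h : Subset n → ℕ} → (∀ v → g v ≤ h v) → ∑ g ≤ ∑ h
∑-mono {zero}  g≤h = g≤h []
∑-mono {suc n} g≤h = +-mono-≤ (∑-mono (g≤h ∘ (outside ∷_))) (∑-mono (g≤h ∘ (inside ∷_)))

∑-mono-< : {g h : Subset n → ℕ} → (∀ v → g v ≤ h v) → ∀ w → g w < h w → ∑ g < ∑ h
∑-mono-< g≤h []            lt = lt
∑-mono-< g≤h (outside ∷ w) lt =
  +-mono-<-≤ (∑-mono-< (g≤h ∘ (outside ∷_)) w lt) (∑-mono (g≤h ∘ (inside ∷_)))
∑-mono-< g≤h (inside ∷ w)  lt =
  +-mono-≤-< (∑-mono (g≤h ∘ (outside ∷_))) (∑-mono-< (g≤h ∘ (inside ∷_)) w lt)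

∑-cong : {g h : Subset n → ℕ} → (∀ v → g v ≡ h v) → ∑ g ≡ ∑ h
∑-cong g≗h = ≤-antisym (∑-mono (≤-reflexive ∘ g≗h)) (∑-mono (≤-reflexive ∘ sym ∘ g≗h))

+-interchange : ∀ a b c d → (a + b) + (c + d) ≡ (a + c) + (b + d)
+-interchange = solve-∀

∑-+ : (g h : Subset n → ℕ) → ∑ (λ v → g v + h v) ≡ ∑ g + ∑ h
∑-+ {zero}  g h = refl
∑-+ {suc n} g h = trans
  (cong₂ _+_ (∑-+ (g ∘ (outside ∷_)) (h ∘ (outside ∷_))) (∑-+ (g ∘ (inside ∷_)) (h ∘ (inside ∷_))))
  (+-interchange (∑ (g ∘ (outside ∷_))) _ _ _)

∑-*ʳ : (g : Subset n → ℕ) (c : ℕ) → ∑ (λ v → g v * c) ≡ ∑ g * c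
∑-*ʳ {zero}  g c = refl
∑-*ʳ {suc n} g c = trans
  (cong₂ _+_ (∑-*ʳ (g ∘ (outside ∷_)) c) (∑-*ʳ (g ∘ (inside ∷_)) c))
  (sym (*-distribʳ-+ c (∑ (g ∘ (outside ∷_))) _))

𝟙 : Bool → ℕ
𝟙 true  = 1
𝟙 false = 0

Fam : ℕ → Set
Fam n = Subset n → Bool

cnt : Fam n → ℕ
cnt P = ∑ (𝟙 ∘ P)

𝟙-mono : ∀ {a b} → (T a → T b) → 𝟙 a ≤ 𝟙 b
𝟙-mono {true}  {true}  _ = ≤-refl
𝟙-mono {true}  {false} h = ⊥-elim (h tt)
𝟙-mono {false}         _ = z≤n

cnt-mono : {P Q : Fam n} → (∀ v → T (P v) → T (Q v)) → cnt P ≤ cnt Q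
cnt-mono P⇒Q = ∑-mono (𝟙-mono ∘ P⇒Q)

∑-zero : {g : Subset n → ℕ} → (∀ v → g v ≡ 0) → ∑ g ≡ 0
∑-zero {zero}  g≗0 = g≗0 []
∑-zero {suc n} g≗0 = cong₂ _+_ (∑-zero (g≗0 ∘ (outside ∷_))) (∑-zero (g≗0 ∘ (inside ∷_)))

cnt-empty : {P : Fam n} → (∀ v → ¬ T (P v)) → cnt P ≡ 0
cnt-empty {P = P} empty = ∑-zero λ v → 𝟙-false (empty v)
  where
  𝟙-false : ∀ {a} → ¬ T a → 𝟙 a ≡ 0
  𝟙-false {true}  ¬a = ⊥-elim (¬a tt)
  𝟙-false {false} _  = refl

-- Uniform and intersecting families and their shadows

Uniform : ℕ → Fam n → Set
Uniform k P = ∀ v → T (P v) → ∣ v ∣ ≡ k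

TIntersecting : ℕ → Fam n → Set
TIntersecting t P = ∀ v w → T (P v) → T (P w) → t ≤ ∣ v ∩ w ∣

-- The size of G is compared with that of F itself, so no uniformity k enters and no subtraction is
-- truncated.
InShadow : ℕ → Fam n → Subset n → Set
InShadow j P G = ∃ λ F → T (P F) × G ⊆ F × ∣ G ∣ + j ≡ ∣ F ∣

inShadow? : ∀ j (P : Fam n) G → Dec (InShadow j P G)
inShadow? j P G = anySubset? λ F → T? (P F) ×-dec (G ⊆? F) ×-dec (∣ G ∣ + j ≟ ∣ F ∣)

abstract
  shadow : ℕ → Fam n → Fam n
  shadow j P G = ⌊ inShadow? j P G ⌋

  shadow⁺ : ∀ j (P : Fam n) {G} → InShadow j P G → T (shadow j P G)
  shadow⁺ j P {G} = fromWitness {a? = inShadow? j P G}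

  shadow⁻ : ∀ j (P : Fam n) {G} → T (shadow j P G) → InShadow j P G
  shadow⁻ j P {G} = toWitness {a? = inShadow? j P G}

-- Adjacent shifting

-- The head of a vector is the largest element of the ground set; shifting
-- moves elements away from the head.  At the last index adj is the identity.
adj : Fin n → Subset n → Subset n
adj zero    (b ∷ [])    = b ∷ []
adj zero    (b ∷ c ∷ v) = c ∷ b ∷ v
adj (suc p) (b ∷ v)     = b ∷ adj p v

data Dir : Set where
  up dn flat : Dir

opp : Dir → Dir
opp up = dn
opp dn = up
opp flat = flat

dir : Fin n → Subset n → Dir
dir zero    (b ∷ [])              = flat
dir zero    (inside ∷ outside ∷ v) = up
dir zero    (outside ∷ inside ∷ v) = dn
dir zero    (_ ∷ _ ∷ v)           = flat
dir (suc p) (b ∷ v)               = dir p v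

adj-involutive : (p : Fin n) (v : Subset n) → adj p (adj p v) ≡ v
adj-involutive zero    (b ∷ [])    = refl
adj-involutive zero    (b ∷ c ∷ v) = refl
adj-involutive (suc p) (b ∷ v)     = cong (b ∷_) (adj-involutive p v)

dir-adj : (p : Fin n) (v : Subset n) → dir p (adj p v) ≡ opp (dir p v)
dir-adj zero    (b ∷ [])                 = refl
dir-adj zero    (inside ∷ inside ∷ v)    = refl
dir-adj zero    (inside ∷ outside ∷ v)   = refl
dir-adj zero    (outside ∷ inside ∷ v)   = refl
dir-adj zero    (outside ∷ outside ∷ v)  = refl
dir-adj (suc p) (b ∷ v)                  = dir-adj p v

adj-eq : (p : Fin n) (v : Subset n) → dir p v ≡ flat → adj p v ≡ v
adj-eq zero    (b ∷ [])                _ = refl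
adj-eq zero    (inside ∷ inside ∷ v)   _ = refl
adj-eq zero    (outside ∷ outside ∷ v) _ = refl
adj-eq (suc p) (b ∷ v)                 e = cong (b ∷_) (adj-eq p v e)

∣adj∣ : (p : Fin n) (v : Subset n) → ∣ adj p v ∣ ≡ ∣ v ∣
∣adj∣ zero    (b ∷ [])                = refl
∣adj∣ zero    (inside ∷ inside ∷ v)   = refl
∣adj∣ zero    (inside ∷ outside ∷ v)  = refl
∣adj∣ zero    (outside ∷ inside ∷ v)  = refl
∣adj∣ zero    (outside ∷ outside ∷ v) = refl
∣adj∣ (suc p) (inside ∷ v)            = cong suc (∣adj∣ p v)
∣adj∣ (suc p) (outside ∷ v)           = ∣adj∣ p v

adj-∩ : (p : Fin n) (v w : Subset n) → adj p v ∩ adj p w ≡ adj p (v ∩ w)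
adj-∩ zero    (b ∷ [])    (c ∷ [])     = refl
adj-∩ zero    (b ∷ c ∷ v) (d ∷ e ∷ w)  = refl
adj-∩ (suc p) (b ∷ v)     (c ∷ w)      = cong (_ ∷_) (adj-∩ p v w)

∣adj∩adj∣ : (p : Fin n) (v w : Subset n) → ∣ adj p v ∩ adj p w ∣ ≡ ∣ v ∩ w ∣
∣adj∩adj∣ p v w = trans (cong ∣_∣ (adj-∩ p v w)) (∣adj∣ p (v ∩ w))

∣∷∣-mono : ∀ b (v w : Subset n) → ∣ v ∣ ≤ ∣ w ∣ → ∣ b ∷ v ∣ ≤ ∣ b ∷ w ∣
∣∷∣-mono inside  _ _ = s≤s
∣∷∣-mono outside _ _ = λ le → le

-- Both sets contain the smaller of the two exchanged elements and not the larger, so an exchange in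
-- v alone destroys a common element.
adj∩-dn : (p : Fin n) (v w : Subset n) → dir p v ≡ dn → dir p w ≡ dn → ∣ adj p v ∩ w ∣ ≤ ∣ v ∩ w ∣
adj∩-dn zero    (outside ∷ inside ∷ v) (outside ∷ inside ∷ w) _ _ = n≤1+n _
adj∩-dn zero    (outside ∷ outside ∷ v) _ () _
adj∩-dn zero    (inside ∷ outside ∷ v) _ () _
adj∩-dn zero    (inside ∷ inside ∷ v) _ () _
adj∩-dn zero    (outside ∷ inside ∷ v) (outside ∷ outside ∷ w) _ ()
adj∩-dn zero    (outside ∷ inside ∷ v) (inside ∷ outside ∷ w) _ ()
adj∩-dn zero    (outside ∷ inside ∷ v) (inside ∷ inside ∷ w) _ ()
adj∩-dn (suc p) (b ∷ v) (c ∷ w) e f = ∣∷∣-mono (b ∧ c) (adj p v ∩ w) (v ∩ w) (adj∩-dn p v w e f)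

adj-⊆ : (p : Fin n) {v w : Subset n} → v ⊆ w → adj p v ⊆ adj p w
adj-⊆ zero    {b ∷ []}    {c ∷ []}    h = h
adj-⊆ zero    {b ∷ c ∷ v} {d ∷ e ∷ w} h here with h (there here)
... | there here = here
adj-⊆ zero    {b ∷ c ∷ v} {d ∷ e ∷ w} h (there here) with h here
... | here = there here
adj-⊆ zero    {b ∷ c ∷ v} {d ∷ e ∷ w} h (there (there x)) with h (there (there x))
... | there (there y) = there (there y)
adj-⊆ (suc p) {b ∷ v} {c ∷ w} h here with h here
... | here = here
adj-⊆ (suc p) {b ∷ v} {c ∷ w} h (there x) = there (adj-⊆ p (λ y → drop (h (there y))) x)
  where
  drop : ∀ {x s} → (s ∷ w) [ suc x ]= inside → w [ x ]= inside
  drop (there z) = z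

∑-adj : (p : Fin n) (g : Subset n → ℕ) → ∑ (g ∘ adj p) ≡ ∑ g
∑-adj {suc zero}    zero    g = refl
∑-adj {suc (suc n)} zero    g = +-interchange (∑ {n} (λ v → g (outside ∷ outside ∷ v))) _ _ _
∑-adj {suc n}       (suc p) g = cong₂ _+_ (∑-adj p (g ∘ (outside ∷_))) (∑-adj p (g ∘ (inside ∷_)))

-- The sum of the elements, the head of a vector of length `suc n` being n + 1.
weight : Subset n → ℕ
weight []              = 0
weight (outside ∷ v)   = weight v
weight {suc n} (inside ∷ v) = suc n + weight v

weight-adj : (p : Fin n) (v : Subset n) → dir p v ≡ up → weight (adj p v) < weight v
weight-adj zero    (inside ∷ outside ∷ v) _ = ≤-refl
weight-adj zero    (outside ∷ outside ∷ v) ()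
weight-adj zero    (outside ∷ inside ∷ v) ()
weight-adj zero    (inside ∷ inside ∷ v) ()
weight-adj (suc p) (outside ∷ v) e = weight-adj p v e
weight-adj {suc n} (suc p) (inside ∷ v)  e = +-monoʳ-< (suc n) (weight-adj p v e)

-- If F and `adj p F` differ, the one of direction `dn` is the image under the shift: it enters the
-- shifted family if either lies in P, the other one only if both do.
shiftᵇ : Dir → Bool → Bool → Bool
shiftᵇ up a b = a ∧ b
shiftᵇ dn a b = a ∨ b
shiftᵇ flat a b = a

shift : Fin n → Fam n → Fam n
shift p P F = shiftᵇ (dir p F) (P F) (P (adj p F))

-- `adj p` permutes the subsets, so sums can be compared orbit by orbit; counting twice avoids a
-- choice of representatives.
∑-double : (p : Fin n) (g : Subset n → ℕ) → ∑ g + ∑ g ≡ ∑ (λ v → g v + g (adj p v))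
∑-double p g = trans (cong (∑ g +_) (sym (∑-adj p g))) (sym (∑-+ g (g ∘ adj p)))

double-injective : ∀ a b → a + a ≡ b + b → a ≡ b
double-injective a b e with <-cmp a b
... | tri< a<b _ _ = contradiction e (<⇒≢ (+-mono-< a<b a<b))
... | tri≈ _ a≡b _ = a≡b
... | tri> _ _ b<a = contradiction (sym e) (<⇒≢ (+-mono-< b<a b<a))

double-cancel-< : ∀ {a b} → a + a < b + b → a < b
double-cancel-< {a} {b} lt with a <? b
... | yes a<b = a<b
... | no  a≮b = contradiction lt (≤⇒≯ (+-mono-≤ (≮⇒≥ a≮b) (≮⇒≥ a≮b)))

shift-cnt : (p : Fin n) (P : Fam n) → cnt (shift p P) ≡ cnt P
shift-cnt p P = double-injective _ _ (trans (∑-double p (𝟙 ∘ shift p P))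
  (trans (∑-cong pair) (sym (∑-double p (𝟙 ∘ P)))))
  where
  up-pair : ∀ a b → 𝟙 (a ∧ b) + 𝟙 (b ∨ a) ≡ 𝟙 a + 𝟙 b
  up-pair true  true  = refl
  up-pair true  false = refl
  up-pair false true  = refl
  up-pair false false = refl
  pair : ∀ v → 𝟙 (shift p P v) + 𝟙 (shift p P (adj p v)) ≡ 𝟙 (P v) + 𝟙 (P (adj p v))
  pair v rewrite dir-adj p v | adj-involutive p v with dir p v
  ... | up = up-pair (P v) (P (adj p v))
  ... | dn = trans (+-comm (𝟙 (P v ∨ P (adj p v))) _)
               (trans (up-pair (P (adj p v)) (P v)) (+-comm (𝟙 (P (adj p v))) _))
  ... | flat = refl

totalWeight : Fam n → ℕ
totalWeight P = ∑ λ v → 𝟙 (P v) * weight v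

-- Each orbit keeps its number of members, and a lone member ends up as the lighter set of the two.
-- The orbit of w makes the inequality strict.
shift-totalWeight : (p : Fin n) (P : Fam n) → ∀ w → dir p w ≡ up → T (P w) → ¬ T (P (adj p w)) →
  totalWeight (shift p P) < totalWeight P
shift-totalWeight {n} p P w up-w w∈P adj∉P = double-cancel-< (subst₂ _<_
  (sym (∑-double p _)) (sym (∑-double p _))
  (∑-mono-< pair w strict))
  where
  up-pair : ∀ a b {x y} → y ≤ x → 𝟙 (a ∧ b) * x + 𝟙 (b ∨ a) * y ≤ 𝟙 a * x + 𝟙 b * y
  up-pair true  true  _   = ≤-refl
  up-pair true  false {x} {y} y≤x = subst₂ _≤_ (sym (+-identityʳ y)) (sym (trans (+-identityʳ _) (+-identityʳ x))) y≤x
  up-pair false true  _   = ≤-refl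
  up-pair false false _   = ≤-refl
  pair : ∀ v → 𝟙 (shift p P v) * weight v + 𝟙 (shift p P (adj p v)) * weight (adj p v)
             ≤ 𝟙 (P v) * weight v + 𝟙 (P (adj p v)) * weight (adj p v)
  pair v rewrite dir-adj p v | adj-involutive p v with dir p v in e
  ... | up = up-pair (P v) (P (adj p v)) (<⇒≤ (weight-adj p v e))
  ... | dn = subst₂ _≤_ (+-comm _ (𝟙 (P v ∨ P (adj p v)) * weight v)) (+-comm _ (𝟙 (P v) * weight v))
               (up-pair (P (adj p v)) (P v) (subst (λ z → weight z ≤ weight (adj p v)) (adj-involutive p v)
                 (<⇒≤ (weight-adj p (adj p v) (trans (dir-adj p v) (cong opp e))))))
  ... | flat = ≤-refl
  up-strict : ∀ a b {x y} → T a → ¬ T b → y < x → 𝟙 (a ∧ b) * x + 𝟙 (b ∨ a) * y < 𝟙 a * x + 𝟙 b * y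
  up-strict true true  _ ¬b _ = ⊥-elim (¬b tt)
  up-strict true false {x} {y} _ _ y<x = subst₂ _<_ (sym (+-identityʳ y)) (sym (trans (+-identityʳ _) (+-identityʳ x))) y<x
  strict : 𝟙 (shift p P w) * weight w + 𝟙 (shift p P (adj p w)) * weight (adj p w)
         < 𝟙 (P w) * weight w + 𝟙 (P (adj p w)) * weight (adj p w)
  strict rewrite dir-adj p w | adj-involutive p w | up-w =
    up-strict (P w) (P (adj p w)) w∈P adj∉P (weight-adj p w up-w)

data Shifted (p : Fin n) (P : Fam n) (v : Subset n) : Set where
  kept  : T (P v) → (dir p v ≡ up → T (P (adj p v))) → Shifted p P v
  moved : dir p v ≡ dn → T (P (adj p v)) → Shifted p P v

shifted : (p : Fin n) (P : Fam n) (v : Subset n) → T (shift p P v) → Shifted p P v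
shifted p P v h with dir p v in e | P v in f | P (adj p v) in g
... | up | true  | true  = kept (subst T (sym f) tt) (λ _ → subst T (sym g) tt)
... | dn | true  | _     = kept (subst T (sym f) tt) (λ d → contradiction (trans (sym e) d) λ ())
... | dn | false | true  = moved e (subst T (sym g) tt)
... | flat | true | _    = kept (subst T (sym f) tt) (λ d → contradiction (trans (sym e) d) λ ())

shift-uniform : ∀ {k} (p : Fin n) (P : Fam n) → Uniform k P → Uniform k (shift p P)
shift-uniform p P uni v h with shifted p P v h
... | kept v∈P _  = uni v v∈P
... | moved _ v∈P = trans (sym (∣adj∣ p v)) (uni _ v∈P)

-- Of v it is known only that `adj p v` lies in P. That set is compared with `adj p w`, which is in
-- P if w points `up` and equals w if w is flat, or with w itself if w points `dn`.
shift-mixed : ∀ {t} (p : Fin n) (P : Fam n) → TIntersecting t P → ∀ v w → dir p v ≡ dn → T (P (adj p v)) →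
  T (P w) → (dir p w ≡ up → T (P (adj p w))) → t ≤ ∣ v ∩ w ∣
shift-mixed {t = t} p P int v w dn-v v∈P w∈P w-up with dir p w in e
... | up = subst (t ≤_) (∣adj∩adj∣ p v w) (int _ _ v∈P (w-up refl))
... | dn = ≤-trans (int _ _ v∈P w∈P) (adj∩-dn p v w dn-v e)
... | flat = subst (t ≤_) (∣adj∩adj∣ p v w) (int _ _ v∈P (subst (T ∘ P) (sym (adj-eq p w e)) w∈P))

shift-tInt : ∀ {t} (p : Fin n) (P : Fam n) → TIntersecting t P → TIntersecting t (shift p P)
shift-tInt {t = t} p P int v w hv hw with shifted p P v hv | shifted p P w hw
... | kept v∈P _      | kept w∈P _      = int v w v∈P w∈P
... | moved _ v∈P     | moved _ w∈P     = subst (t ≤_) (∣adj∩adj∣ p v w) (int _ _ v∈P w∈P)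
... | moved dn-v v∈P  | kept w∈P w-up   = shift-mixed p P int v w dn-v v∈P w∈P w-up
... | kept v∈P v-up   | moved dn-w w∈P  =
  subst (t ≤_) (cong ∣_∣ (∩-comm w v)) (shift-mixed p P int w v dn-w w∈P v∈P v-up)

adj-inShadow : ∀ j (p : Fin n) (P : Fam n) {G F} → T (P (adj p F)) → G ⊆ F → ∣ G ∣ + j ≡ ∣ F ∣ →
  T (shadow j P (adj p G))
adj-inShadow j p P {G} {F} F∈P G⊆F size = shadow⁺ j P (adj p F , F∈P , adj-⊆ p G⊆F ,
  trans (cong (_+ j) (∣adj∣ p G)) (trans size (sym (∣adj∣ p F))))

up-⊆ : (p : Fin n) (v w : Subset n) → dir p v ≡ up → v ⊆ w → dir p w ≢ up → dir p w ≡ flat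
up-⊆ zero (inside ∷ outside ∷ v) (inside ∷ inside ∷ w)   _ _ _ = refl
up-⊆ zero (inside ∷ outside ∷ v) (inside ∷ outside ∷ w)  _ _ h = contradiction refl h
up-⊆ zero (inside ∷ outside ∷ v) (outside ∷ c ∷ w)       _ h _ = contradiction (h here) λ ()
up-⊆ zero (outside ∷ outside ∷ v) _ () _ _
up-⊆ zero (outside ∷ inside ∷ v) _ () _ _
up-⊆ zero (inside ∷ inside ∷ v) _ () _ _
up-⊆ (suc p) (b ∷ v) (c ∷ w) e h = up-⊆ p v w e (drop-∷-⊆ h)

-- Together with `shift-cnt` for the shadow, this shows that shifting does not enlarge the shadow.
shift-shadow : ∀ j (p : Fin n) (P : Fam n) G → T (shadow j (shift p P) G) → T (shift p (shadow j P) G)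
shift-shadow j p P G G∈ with shadow⁻ j (shift p P) G∈
... | F , F∈ , G⊆F , size with dir p G in e
... | flat with shifted p P F F∈
...   | kept F∈P _  = shadow⁺ j P (F , F∈P , G⊆F , size)
...   | moved _ F∈P = subst (T ∘ shadow j P) (adj-eq p G e) (adj-inShadow j p P F∈P G⊆F size)
shift-shadow j p P G G∈ | F , F∈ , G⊆F , size | dn with shifted p P F F∈
...   | kept F∈P _  = Equivalence.from T-∨ (inj₁ (shadow⁺ j P (F , F∈P , G⊆F , size)))
...   | moved _ F∈P = Equivalence.from T-∨ (inj₂ (adj-inShadow j p P F∈P G⊆F size))
-- If G points `up`, both G and `adj p G` are needed. As F contains G and hence the larger element,
-- F cannot be a moved set; either `adj p F` equals F or it was in P as well.
shift-shadow j p P G G∈ | F , F∈ , G⊆F , size | up = Equivalence.from T-∧ (both (shifted p P F F∈))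
  where
  both : Shifted p P F → T (shadow j P G) × T (shadow j P (adj p G))
  both (moved dn-F _) =
    contradiction (trans (sym dn-F) (up-⊆ p G F e G⊆F λ u → contradiction (trans (sym dn-F) u) λ ())) λ ()
  both (kept F∈P F-up) = shadow⁺ j P (F , F∈P , G⊆F , size) , adj-inShadow j p P (adjF (dir p F) refl) G⊆F size
    where
    adjF : ∀ d → dir p F ≡ d → T (P (adj p F))
    adjF up f = F-up f
    adjF dn f = subst (T ∘ P) (sym (adj-eq p F (up-⊆ p G F e G⊆F λ u → contradiction (trans (sym f) u) λ ()))) F∈P
    adjF flat f = subst (T ∘ P) (sym (adj-eq p F f)) F∈P

-- Reduction to left-compressed families

infix 4 _⟶_

data _⟶_ : Subset n → Subset n → Set where
  here  : {v : Subset n} → inside ∷ outside ∷ v ⟶ outside ∷ inside ∷ v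
  there : ∀ {b} {v w : Subset n} → v ⟶ w → b ∷ v ⟶ b ∷ w

-- Steps from x + 1 to x generate all replacements of an element by a smaller absent one, so this
-- says that P is left-compressed.
Closed : Fam n → Set
Closed P = ∀ {v w} → v ⟶ w → T (P v) → T (P w)

⟶-adj : {v w : Subset n} → v ⟶ w → ∃ λ p → dir p v ≡ up × adj p v ≡ w
⟶-adj here      = zero , refl , refl
⟶-adj (there s) with ⟶-adj s
... | p , d , e = suc p , d , cong (_ ∷_) e

up? : ∀ d → Dec (d ≡ up)
up? up = yes refl
up? dn = no λ ()
up? flat = no λ ()

Violation : Fam n → Set
Violation P = ∃₂ λ p v → dir p v ≡ up × T (P v) × ¬ T (P (adj p v))

violation? : (P : Fam n) → Dec (Violation P)
violation? P = Fin.any? λ p → anySubset? λ v →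
  up? (dir p v) ×-dec T? (P v) ×-dec ¬? (T? (P (adj p v)))

-- Shifts are applied as long as one of them changes the family; each lowers the total weight, so
-- this ends.
compress : ∀ {t k} j (P : Fam n) → Uniform k P → TIntersecting t P →
  ∃ λ Q → Closed Q × Uniform k Q × TIntersecting t Q × cnt Q ≡ cnt P × cnt (shadow j Q) ≤ cnt (shadow j P)
compress {t = t} {k} j P = go P (<-wellFounded (totalWeight P))
  where
  go : ∀ P → Acc _<_ (totalWeight P) → Uniform k P → TIntersecting t P →
    ∃ λ Q → Closed Q × Uniform k Q × TIntersecting t Q × cnt Q ≡ cnt P × cnt (shadow j Q) ≤ cnt (shadow j P)
  go P (acc rec) uni int with violation? P
  ... | yes (p , v , up-v , v∈P , adj∉P)
      with go (shift p P) (rec (shift-totalWeight p P v up-v v∈P adj∉P))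
              (shift-uniform p P uni) (shift-tInt p P int)
  ...   | Q , closed , uniQ , intQ , size , sh =
          Q , closed , uniQ , intQ , trans size (shift-cnt p P) ,
          ≤-trans sh (≤-trans (cnt-mono (shift-shadow j p P)) (≤-reflexive (shift-cnt p (shadow j P))))
  go P (acc rec) uni int | no none = P , closed , uni , int , refl , ≤-refl
    where
    closed : Closed P
    closed {v} s v∈P with ⟶-adj s
    ... | p , up-v , refl = decidable-stable (T? (P (adj p v))) λ adj∉P → none (p , v , up-v , v∈P , adj∉P)

-- Members of left-compressed families on initial segments

infix 4 _⋖_

data _⋖_ : Subset n → Subset n → Set where
  here  : {v : Subset n} → outside ∷ v ⋖ inside ∷ v
  there : ∀ {b} {v w : Subset n} → v ⋖ w → b ∷ v ⋖ b ∷ w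

⋖⇒⊆ : {v w : Subset n} → v ⋖ w → v ⊆ w
⋖⇒⊆ here      = out⊆ ⊆-refl
⋖⇒⊆ (there a) = s⊆s (⋖⇒⊆ a)

⋖-size : {v w : Subset n} → v ⋖ w → ∣ w ∣ ≡ suc ∣ v ∣
⋖-size here                  = refl
⋖-size (there {b = true} a)  = cong suc (⋖-size a)
⋖-size (there {b = false} a) = ⋖-size a

-- The largest element is traded for a smaller absent one by adjacent steps: it descends through
-- gaps, and at an occupied place the occupant first moves on and leaves its place free.
Closed-replace : {P : Fam (suc n)} → Closed P → ∀ {v w} → v ⋖ w → T (P (inside ∷ v)) → T (P (outside ∷ w))
Closed-replace closed here v∈ = closed here v∈
Closed-replace {P = P} closed (there {b = false} a) v∈ =
  Closed-replace {P = P ∘ (outside ∷_)} (closed ∘ there) a (closed here v∈)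
Closed-replace {P = P} closed (there {b = true} a) v∈ =
  closed here (Closed-replace {P = P ∘ (inside ∷_)} (closed ∘ there) a v∈)

-- Some l satisfies ∣ F ∩ [l] ∣ + ∣ F′ ∩ [l] ∣ ≥ l + t.
data Meet (t : ℕ) : Subset n → Subset n → Set where
  here  : {v w : Subset n} → n + t ≤ ∣ v ∣ + ∣ w ∣ → Meet t v w
  there : ∀ {b c} {v w : Subset n} → Meet t v w → Meet t (b ∷ v) (c ∷ w)

CrossInt : ℕ → Fam n → Fam n → Set
CrossInt t P R = ∀ v w → T (P v) → T (R w) → t ≤ ∣ v ∩ w ∣

Uniform-out : ∀ {k} (P : Fam (suc n)) → Uniform k P → Uniform k (P ∘ (outside ∷_))
Uniform-out P uni v = uni (outside ∷ v)

Uniform-in : ∀ {k} (P : Fam (suc n)) → Uniform k P → Uniform (pred k) (P ∘ (inside ∷_))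
Uniform-in P uni v v∈ = cong pred (uni (inside ∷ v) v∈)

-- An element outside v and w can join v without changing the intersection. If there is none, v ∪ w
-- is everything, and inclusion-exclusion gives the second alternative.
avoiding : (v w : Subset n) → (∃ λ u → v ⋖ u × ∣ u ∩ w ∣ ≡ ∣ v ∩ w ∣) ⊎ n + ∣ v ∩ w ∣ ≤ ∣ v ∣ + ∣ w ∣
avoiding [] [] = inj₂ z≤n
avoiding (outside ∷ v) (outside ∷ w) = inj₁ (inside ∷ v , here , refl)
avoiding (outside ∷ v) (inside ∷ w) with avoiding v w
... | inj₁ (u , a , e) = inj₁ (outside ∷ u , there a , e)
... | inj₂ le = inj₂ (≤-trans (s≤s le) (≤-reflexive (sym (+-suc ∣ v ∣ ∣ w ∣))))
avoiding (inside ∷ v) (outside ∷ w) with avoiding v w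
... | inj₁ (u , a , e) = inj₁ (inside ∷ u , there a , e)
... | inj₂ le = inj₂ (s≤s le)
avoiding {suc n} (inside ∷ v) (inside ∷ w) with avoiding v w
... | inj₁ (u , a , e) = inj₁ (inside ∷ u , there a , cong suc e)
... | inj₂ le = inj₂ (s≤s (subst₂ _≤_ (sym (+-suc n _)) (sym (+-suc ∣ v ∣ ∣ w ∣)) (s≤s le)))

-- Induction on n, peeling off the largest element; two families are needed because it may lie in
-- only one of the sets. In that case, or if it lies in neither, the traces still cross-intersect in
-- t elements.
meet : ∀ {t a b} (P R : Fam n) → Closed P → Uniform a P → Uniform b R → CrossInt t P R →
  ∀ v w → T (P v) → T (R w) → Meet t v w
meet P R closed uniP uniR int [] [] v∈ w∈ = here (int [] [] v∈ w∈)
meet P R closed uniP uniR int (outside ∷ v) (c ∷ w) v∈ w∈ =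
  there (meet (P ∘ (outside ∷_)) (R ∘ (c ∷_)) (closed ∘ there) (λ x h → uniP (outside ∷ x) h)
    (λ x h → trans (size c x) (cong (_∸ 𝟙 c) (uniR (c ∷ x) h))) (λ x y → int (outside ∷ x) (c ∷ y)) v w v∈ w∈)
  where
  size : ∀ c (x : Subset _) → ∣ x ∣ ≡ ∣ c ∷ x ∣ ∸ 𝟙 c
  size inside  x = refl
  size outside x = refl
meet P R closed uniP uniR int (inside ∷ v) (outside ∷ w) v∈ w∈ =
  there (meet (P ∘ (inside ∷_)) (R ∘ (outside ∷_)) (closed ∘ there) (Uniform-in P uniP)
    (Uniform-out R uniR) (λ x y → int (inside ∷ x) (outside ∷ y)) v w v∈ w∈)
meet {suc n} {t} {a} {b} P R closed uniP uniR int (inside ∷ v) (inside ∷ w) v∈ w∈ with suc n + t ≤? a + b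
... | yes le = here (subst (suc n + t ≤_) (sym (cong₂ _+_ (uniP _ v∈) (uniR _ w∈))) le)
... | no  ¬le = there (meet (P ∘ (inside ∷_)) (R ∘ (inside ∷_)) (closed ∘ there) (Uniform-in P uniP)
                   (Uniform-in R uniR) int′ v w v∈ w∈)
  where
  int′ : CrossInt t (P ∘ (inside ∷_)) (R ∘ (inside ∷_))
  -- Either the common largest element is traded for one outside x and y and no longer counts in the
  -- intersection, or x ∪ y is everything, which would give n + 1 + t ≤ a + b.
  int′ x y x∈ y∈ with avoiding x y
  ... | inj₁ (u , a , e) = subst (t ≤_) e (int (outside ∷ u) (inside ∷ y) (Closed-replace {P = P} closed a x∈) y∈)
  ... | inj₂ le with t ≤? ∣ x ∩ y ∣
  ...   | yes t≤ = t≤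
  ...   | no  t≰ = contradiction (begin
    suc n + t            ≤⟨ +-monoʳ-≤ (suc n) (int (inside ∷ x) (inside ∷ y) x∈ y∈) ⟩
    suc n + suc ∣ x ∩ y ∣  ≡⟨ cong suc (+-suc n _) ⟩
    suc (suc (n + ∣ x ∩ y ∣)) ≤⟨ s≤s (s≤s le) ⟩
    suc (suc (∣ x ∣ + ∣ y ∣)) ≡⟨ cong suc (+-suc ∣ x ∣ ∣ y ∣) ⟨
    suc ∣ x ∣ + suc ∣ y ∣ ≡⟨ cong₂ _+_ (uniP _ x∈) (uniR _ y∈) ⟩
    a + b ∎) ¬le
    where open ≤-Reasoning

-- The local LYM inequality

-- The sums of g over the sets covering v and over the sets covered by v, in the sense of `⋖`.
upSum downSum : (Subset n → ℕ) → Subset n → ℕ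
upSum g []            = 0
upSum g (outside ∷ v) = g (inside ∷ v) + upSum (g ∘ (outside ∷_)) v
upSum g (inside ∷ v)  = upSum (g ∘ (inside ∷_)) v
downSum g []            = 0
downSum g (outside ∷ v) = downSum (g ∘ (outside ∷_)) v
downSum g (inside ∷ v)  = g (outside ∷ v) + downSum (g ∘ (inside ∷_)) v

∑-*-+ : (f g h : Subset n → ℕ) → ∑ (λ v → f v * (g v + h v)) ≡ ∑ (λ v → f v * g v) + ∑ (λ v → f v * h v)
∑-*-+ f g h = trans (∑-cong λ v → *-distribˡ-+ (f v) (g v) (h v)) (∑-+ (λ v → f v * g v) (λ v → f v * h v))

-- Double counting: both sides sum h v * g w over the pairs v ⋖ w.
∑-upSum-downSum : (g h : Subset n → ℕ) → ∑ (λ v → h v * upSum g v) ≡ ∑ (λ w → g w * downSum h w)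
∑-upSum-downSum {zero}  g h = trans (*-zeroʳ (h [])) (sym (*-zeroʳ (g [])))
∑-upSum-downSum {suc n} g h = begin
  ∑ (λ v → h₀ v * (g₁ v + upSum g₀ v)) + ∑ (λ v → h₁ v * upSum g₁ v)
    ≡⟨ cong₂ _+_ (∑-*-+ h₀ g₁ (upSum g₀)) (∑-upSum-downSum g₁ h₁) ⟩
  (∑ (λ v → h₀ v * g₁ v) + ∑ (λ v → h₀ v * upSum g₀ v)) + ∑ (λ v → g₁ v * downSum h₁ v)
    ≡⟨ cong (_+ ∑ (λ v → g₁ v * downSum h₁ v)) (cong₂ _+_ (∑-cong λ v → *-comm (h₀ v) (g₁ v)) (∑-upSum-downSum g₀ h₀)) ⟩
  (∑ (λ v → g₁ v * h₀ v) + ∑ (λ v → g₀ v * downSum h₀ v)) + ∑ (λ v → g₁ v * downSum h₁ v)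
    ≡⟨ rotate (∑ (λ v → g₁ v * h₀ v)) _ _ ⟩
  ∑ (λ v → g₀ v * downSum h₀ v) + (∑ (λ v → g₁ v * h₀ v) + ∑ (λ v → g₁ v * downSum h₁ v))
    ≡⟨ cong (∑ (λ v → g₀ v * downSum h₀ v) +_) (∑-*-+ g₁ h₀ (downSum h₁)) ⟨
  ∑ (λ v → g₀ v * downSum h₀ v) + ∑ (λ v → g₁ v * (h₀ v + downSum h₁ v)) ∎
  where
  open ≡-Reasoning
  g₀ = g ∘ (outside ∷_)
  g₁ = g ∘ (inside ∷_)
  h₀ = h ∘ (outside ∷_)
  h₁ = h ∘ (inside ∷_)
  rotate : ∀ a b c → (a + b) + c ≡ b + (a + c)
  rotate = solve-∀

∣∣≤downSum : (h : Subset n → ℕ) (w : Subset n) → (∀ v → v ⋖ w → 1 ≤ h v) → ∣ w ∣ ≤ downSum h w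
∣∣≤downSum h []            _   = z≤n
∣∣≤downSum h (outside ∷ w) pos = ∣∣≤downSum (h ∘ (outside ∷_)) w (λ v a → pos _ (there a))
∣∣≤downSum h (inside ∷ w)  pos =
  +-mono-≤ (pos _ here) (∣∣≤downSum (h ∘ (inside ∷_)) w (λ v a → pos _ (there a)))

upSum+∣∣≤n : (g : Subset n → ℕ) → (∀ v → g v ≤ 1) → ∀ v → upSum g v + ∣ v ∣ ≤ n
upSum+∣∣≤n g g≤1 []            = z≤n
upSum+∣∣≤n g g≤1 (outside ∷ v) =
  ≤-trans (≤-reflexive (+-assoc (g (inside ∷ v)) _ _)) (+-mono-≤ (g≤1 _) (upSum+∣∣≤n _ (g≤1 ∘ (outside ∷_)) v))
upSum+∣∣≤n {suc n} g g≤1 (inside ∷ v)  =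
  ≤-trans (≤-reflexive (+-suc _ ∣ v ∣)) (s≤s (upSum+∣∣≤n _ (g≤1 ∘ (inside ∷_)) v))

𝟙≤1 : ∀ b → 𝟙 b ≤ 1
𝟙≤1 true  = ≤-refl
𝟙≤1 false = z≤n

𝟙-T : ∀ {b} → T b → 1 ≤ 𝟙 b
𝟙-T {true} _ = ≤-refl

𝟙-*-mono : ∀ b {x y} → (T b → x ≤ y) → 𝟙 b * x ≤ 𝟙 b * y
𝟙-*-mono true  x≤y = *-monoʳ-≤ 1 (x≤y tt)
𝟙-*-mono false _   = z≤n

shadow-uniform : ∀ {k} j (P : Fam n) → Uniform (k + j) P → Uniform k (shadow j P)
shadow-uniform {k = k} j P uni G G∈ with shadow⁻ j P G∈
... | F , F∈P , _ , size = +-cancelʳ-≡ j ∣ G ∣ k (trans size (uni F F∈P))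

-- Counts the pairs of a member and a set covered by it: every member is in k + 1 of them, every set
-- of the shadow in at most n - k = o + 1.
local-LYM₁ : ∀ {k o} (P : Fam n) → Uniform (suc k) P → n ≡ k + suc o → cnt P * suc k ≤ cnt (shadow 1 P) * suc o
local-LYM₁ {n} {k} {o} P uni n≡ = begin
  cnt P * suc k                                ≡⟨ ∑-*ʳ (𝟙 ∘ P) (suc k) ⟨
  ∑ (λ w → 𝟙 (P w) * suc k)                    ≤⟨ ∑-mono (λ w → 𝟙-*-mono (P w) (down w)) ⟩
  ∑ (λ w → 𝟙 (P w) * downSum (𝟙 ∘ S) w)        ≡⟨ ∑-upSum-downSum (𝟙 ∘ P) (𝟙 ∘ S) ⟨
  ∑ (λ v → 𝟙 (S v) * upSum (𝟙 ∘ P) v)          ≤⟨ ∑-mono (λ v → 𝟙-*-mono (S v) (up′ v)) ⟩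
  ∑ (λ v → 𝟙 (S v) * suc o)                    ≡⟨ ∑-*ʳ (𝟙 ∘ S) (suc o) ⟩
  cnt S * suc o                                ∎
  where
  open ≤-Reasoning
  S = shadow 1 P
  down : ∀ w → T (P w) → suc k ≤ downSum (𝟙 ∘ S) w
  down w w∈P = subst (_≤ downSum (𝟙 ∘ S) w) (uni w w∈P)
    (∣∣≤downSum (𝟙 ∘ S) w λ v a → 𝟙-T (shadow⁺ 1 P (w , w∈P , ⋖⇒⊆ a , trans (+-comm ∣ v ∣ 1) (sym (⋖-size a)))))
  up′ : ∀ v → T (S v) → upSum (𝟙 ∘ P) v ≤ suc o
  up′ v v∈S = +-cancelʳ-≤ k _ _ (begin
    upSum (𝟙 ∘ P) v + k     ≡⟨ cong (upSum (𝟙 ∘ P) v +_) (shadow-uniform 1 P (subst (λ z → Uniform z P) (+-comm 1 k) uni) v v∈S) ⟨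
    upSum (𝟙 ∘ P) v + ∣ v ∣ ≤⟨ upSum+∣∣≤n (𝟙 ∘ P) (𝟙≤1 ∘ P) v ⟩
    n                       ≡⟨ trans n≡ (+-comm k (suc o)) ⟩
    suc o + k               ∎)

-- The rising factorial x (x + 1) ... (x + j - 1). For n = a + j + o the quotient C(n, a) / C(n, a +
-- j) is `rise (suc a) j` over `rise (suc o) j`.
rise : ℕ → ℕ → ℕ
rise x zero    = 1
rise x (suc j) = x * rise (suc x) j

rise-suc : ∀ x j → rise x (suc j) ≡ rise x j * (x + j)
rise-suc x zero    = trans (*-comm x 1) (cong (1 *_) (sym (+-identityʳ x)))
rise-suc x (suc j) = begin
  x * rise (suc x) (suc j)           ≡⟨ cong (x *_) (rise-suc (suc x) j) ⟩
  x * (rise (suc x) j * (suc x + j)) ≡⟨ *-assoc x _ _ ⟨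
  x * rise (suc x) j * (suc x + j)   ≡⟨ cong (x * rise (suc x) j *_) (+-suc x j) ⟨
  x * rise (suc x) j * (x + suc j)   ∎
  where open ≡-Reasoning

rise-pos : ∀ x j → 0 < rise (suc x) j
rise-pos x zero    = s≤s z≤n
rise-pos x (suc j) = *-mono-< {0} {suc x} {0} (s≤s z≤n) (rise-pos (suc x) j)

shadow-trans : ∀ j (P : Fam n) G → T (shadow j (shadow 1 P) G) → T (shadow (suc j) P G)
shadow-trans j P G G∈ with shadow⁻ j (shadow 1 P) G∈
... | F , F∈ , G⊆F , size with shadow⁻ 1 P F∈
... | E , E∈P , F⊆E , size′ = shadow⁺ (suc j) P (E , E∈P , ⊆-trans G⊆F F⊆E ,
  (begin
    ∣ G ∣ + suc j   ≡⟨ +-suc ∣ G ∣ j ⟩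
    suc (∣ G ∣ + j) ≡⟨ cong suc size ⟩
    suc ∣ F ∣       ≡⟨ +-comm 1 ∣ F ∣ ⟩
    ∣ F ∣ + 1       ≡⟨ size′ ⟩
    ∣ E ∣           ∎))
  where open ≡-Reasoning

local-LYM : ∀ j {k o} (P : Fam n) → Uniform (k + j) P → n ≡ k + j + o →
  cnt P * rise (suc k) j ≤ cnt (shadow j P) * rise (suc o) j
local-LYM zero {k} P uni n≡ = *-monoˡ-≤ 1 (cnt-mono λ v v∈P →
  shadow⁺ 0 P (v , v∈P , ⊆-refl , +-identityʳ ∣ v ∣))
local-LYM (suc j) {k} {o} P uni n≡ = begin
  cnt P * rise (suc k) (suc j)                    ≡⟨ cong (cnt P *_) (trans (rise-suc (suc k) j) (*-comm (rise (suc k) j) _)) ⟩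
  cnt P * (suc (k + j) * rise (suc k) j)          ≡⟨ *-assoc (cnt P) _ _ ⟨
  cnt P * suc (k + j) * rise (suc k) j            ≤⟨ *-monoˡ-≤ (rise (suc k) j) (local-LYM₁ P uni′ (trans n≡ eq₁)) ⟩
  cnt S * suc o * rise (suc k) j                  ≡⟨ swap (cnt S) (suc o) (rise (suc k) j) ⟩
  suc o * (cnt S * rise (suc k) j)                ≤⟨ *-monoʳ-≤ (suc o) (local-LYM j S uniS (trans n≡ eq₂)) ⟩
  suc o * (cnt (shadow j S) * rise (suc (suc o)) j) ≤⟨ *-monoʳ-≤ (suc o) (*-monoˡ-≤ (rise (suc (suc o)) j) (cnt-mono (shadow-trans j P))) ⟩
  suc o * (cnt (shadow (suc j) P) * rise (suc (suc o)) j) ≡⟨ swap′ (suc o) (cnt (shadow (suc j) P)) _ ⟩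
  cnt (shadow (suc j) P) * rise (suc o) (suc j)   ∎
  where
  open ≤-Reasoning
  S = shadow 1 P
  uni′ : Uniform (suc (k + j)) P
  uni′ = subst (λ z → Uniform z P) (+-suc k j) uni
  uniS : Uniform (k + j) S
  uniS = shadow-uniform 1 P (subst (λ z → Uniform z P) (+-comm 1 (k + j)) uni′)
  eq₁ : k + suc j + o ≡ k + j + suc o
  eq₁ = trans (cong (_+ o) (+-suc k j)) (sym (+-suc (k + j) o))
  eq₂ : k + suc j + o ≡ k + j + suc o
  eq₂ = eq₁
  swap : ∀ a b c → a * b * c ≡ b * (a * c)
  swap = solve-∀
  swap′ : ∀ a b c → a * (b * c) ≡ b * (a * c)
  swap′ = solve-∀

-- Some final segment v of the given vector, of length l, satisfies Q l ∣ v ∣; it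
-- is the trace of the set on [l].
data Hit (Q : ℕ → ℕ → Set) : Subset n → Set where
  here  : {v : Subset n} → Q n ∣ v ∣ → Hit Q v
  there : ∀ {b} {v : Subset n} → Hit Q v → Hit Q (b ∷ v)

-- Families whose members all hit a given line

cnt-oversize : ∀ {k} (P : Fam n) → Uniform k P → n < k → cnt P ≡ 0
cnt-oversize P uni n<k = cnt-empty λ v v∈P → <⇒≱ n<k (subst (_≤ _) (uni v v∈P) (∣p∣≤n v))

shadow-in : ∀ j (P : Fam (suc n)) v → T (shadow j (P ∘ (inside ∷_)) v) → T (shadow j P (inside ∷ v))
shadow-in j P v v∈ with shadow⁻ j (P ∘ (inside ∷_)) v∈
... | F , F∈ , v⊆F , size = shadow⁺ j P (inside ∷ F , F∈ , s⊆s v⊆F , cong suc size)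

shadow-out : ∀ j (P : Fam (suc n)) v → T (shadow j (P ∘ (outside ∷_)) v) → T (shadow j P (outside ∷ v))
shadow-out j P v v∈ with shadow⁻ j (P ∘ (outside ∷_)) v∈
... | F , F∈ , v⊆F , size = shadow⁺ j P (outside ∷ F , F∈ , s⊆s v⊆F , size)

shadow-split : ∀ j (P : Fam (suc n)) →
  cnt (shadow j (P ∘ (outside ∷_))) + cnt (shadow j (P ∘ (inside ∷_))) ≤ cnt (shadow j P)
shadow-split j P = +-mono-≤ (cnt-mono (shadow-out j P)) (cnt-mono (shadow-in j P))

-- The ratio to be proved is A / B; by the parameter `ratio`, local LYM yields it for k-uniform
-- families on [n] with Q n k.
module Block (Q : ℕ → ℕ → Set) (Q? : ∀ n k → Dec (Q n k)) (A B j : ℕ)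
  (j≤ : ∀ n k → k ≤ n → Q n k → j ≤ k)
  (ratio : ∀ k o → Q (k + j + o) (k + j) → A * rise (suc o) j ≤ B * rise (suc k) j) where

  LYM-case : ∀ {k} (P : Fam n) → Uniform k P → Q n k → A * cnt P ≤ B * cnt (shadow j P)
  LYM-case {n} {k} P uni q with k ≤? n
  ... | no  k≰n = subst (_≤ B * cnt (shadow j P)) (sym (trans (cong (A *_) (cnt-oversize P uni (≰⇒> k≰n))) (*-zeroʳ A))) z≤n
  ... | yes k≤n with m≤n⇒∃[o]m+o≡n k≤n | m≤n⇒∃[o]m+o≡n (j≤ n k k≤n q)
  ...   | o , refl | k′ , refl = *-cancelʳ-≤ _ _ (rise (suc k′) j) {{>-nonZero (rise-pos k′ j)}} (begin
    A * cnt P * rise (suc k′) j            ≡⟨ *-assoc A _ _ ⟩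
    A * (cnt P * rise (suc k′) j)          ≤⟨ *-monoʳ-≤ A (local-LYM j P (subst (λ z → Uniform z P) j+k′ uni) (cong (_+ o) j+k′)) ⟩
    A * (cnt (shadow j P) * rise (suc o) j) ≡⟨ swap A (cnt (shadow j P)) _ ⟩
    cnt (shadow j P) * (A * rise (suc o) j) ≤⟨ *-monoʳ-≤ (cnt (shadow j P)) (ratio k′ o (subst (λ z → Q (z + o) z) j+k′ q)) ⟩
    cnt (shadow j P) * (B * rise (suc k′) j) ≡⟨ swap′ (cnt (shadow j P)) B _ ⟩
    B * cnt (shadow j P) * rise (suc k′) j ∎)
    where
    open ≤-Reasoning
    j+k′ = +-comm j k′
    swap : ∀ a b c → a * (b * c) ≡ b * (a * c)
    swap = solve-∀
    swap′ : ∀ a b c → a * (b * c) ≡ b * a * c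
    swap′ = solve-∀

  -- Splitting by the largest element is repeated until Q holds for the traces, so each member is
  -- cut at its last possible l. The elements cut off are kept, hence the parts have disjoint
  -- shadows and the bounds add up.
  block : ∀ {k} (P : Fam n) → Uniform k P → (∀ v → T (P v) → Hit Q v) → A * cnt P ≤ B * cnt (shadow j P)
  block {n} {k} P uni hit with Q? n k
  ... | yes q = LYM-case P uni q
  block {zero} {k} P uni hit | no ¬q =
    subst (_≤ B * cnt (shadow j P)) (sym (trans (cong (A *_) (cnt-empty {P = P} none)) (*-zeroʳ A))) z≤n
    where
    none : ∀ v → ¬ T (P v)
    none v v∈P with hit v v∈P
    ... | here q = ¬q (subst (Q 0) (uni v v∈P) q)
  block {suc n} {k} P uni hit | no ¬q = begin
    A * (cnt P₀ + cnt P₁)                              ≡⟨ *-distribˡ-+ A (cnt P₀) _ ⟩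
    A * cnt P₀ + A * cnt P₁                            ≤⟨ +-mono-≤ (block P₀ (Uniform-out P uni) (hit-∷ outside))
                                                                   (block P₁ (Uniform-in P uni) (hit-∷ inside)) ⟩
    B * cnt (shadow j P₀) + B * cnt (shadow j P₁)      ≡⟨ *-distribˡ-+ B (cnt (shadow j P₀)) _ ⟨
    B * (cnt (shadow j P₀) + cnt (shadow j P₁))        ≤⟨ *-monoʳ-≤ B (shadow-split j P) ⟩
    B * cnt (shadow j P)                               ∎
    where
    open ≤-Reasoning
    P₀ = P ∘ (outside ∷_)
    P₁ = P ∘ (inside ∷_)
    hit-∷ : ∀ b v → T (P (b ∷ v)) → Hit Q v
    hit-∷ b v v∈P with hit (b ∷ v) v∈P
    ... | here q  = ⊥-elim (¬q (subst (Q (suc n)) (uni _ v∈P) q))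
    ... | there h = h

-- Binomial coefficients and rising factorials

C-factorial : ∀ a b → ((a + b) C a) * (a ! * b !) ≡ (a + b) !
C-factorial a b = begin
  ((a + b) C a) * (a ! * b !)             ≡⟨ cong (λ z → ((a + b) C a) * (a ! * z !)) (m+n∸m≡n a b) ⟨
  ((a + b) C a) * (a ! * (a + b ∸ a) !)   ≡⟨ cong (_* (a ! * (a + b ∸ a) !)) (nCk≡n!/k![n-k]! (m≤m+n a b)) ⟩
  _                                     ≡⟨ m/n*n≡m (k![n∸k]!∣n! (m≤m+n a b)) ⟩
  (a + b) !                             ∎
  where
  open ≡-Reasoning
  instance _ = a !* (a + b ∸ a) !≢0

rise-! : ∀ a j → (a + j) ! ≡ a ! * rise (suc a) j
rise-! a zero    = trans (cong _! (+-identityʳ a)) (sym (*-identityʳ (a !)))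
rise-! a (suc j) = begin
  (a + suc j) !                  ≡⟨ cong _! (+-suc a j) ⟩
  (suc a + j) !                  ≡⟨ rise-! (suc a) j ⟩
  (suc a * a !) * rise (2 + a) j ≡⟨ swap (suc a) (a !) _ ⟩
  a ! * (suc a * rise (2 + a) j) ∎
  where
  open ≡-Reasoning
  swap : ∀ a b c → a * b * c ≡ b * (a * c)
  swap = solve-∀

-- Multiplied by a! o!, both sides become (a + j + o)!.
C-rise : ∀ a j o → ((a + j + o) C (a + j)) * rise (suc a) j ≡ ((a + j + o) C a) * rise (suc o) j
C-rise a j o = *-cancelʳ-≡ _ _ (a ! * o !) {{a !* o !≢0}} (begin
  ((a + j + o) C (a + j)) * rise (suc a) j * (a ! * o !)   ≡⟨ lhs ((a + j + o) C (a + j)) (rise (suc a) j) (a !) (o !) ⟩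
  ((a + j + o) C (a + j)) * (a ! * rise (suc a) j * o !)   ≡⟨ cong (λ z → ((a + j + o) C (a + j)) * (z * o !)) (rise-! a j) ⟨
  ((a + j + o) C (a + j)) * ((a + j) ! * o !)              ≡⟨ C-factorial (a + j) o ⟩
  (a + j + o) !                                          ≡⟨ cong _! assoc ⟩
  (a + (o + j)) !                                        ≡⟨ C-factorial a (o + j) ⟨
  ((a + (o + j)) C a) * (a ! * (o + j) !)                  ≡⟨ cong₂ (λ x y → (x C a) * (a ! * y)) (sym assoc) (rise-! o j) ⟩
  ((a + j + o) C a) * (a ! * (o ! * rise (suc o) j))       ≡⟨ rhs ((a + j + o) C a) (rise (suc o) j) (a !) (o !) ⟩
  ((a + j + o) C a) * rise (suc o) j * (a ! * o !)         ∎)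
  where
  open ≡-Reasoning
  assoc : a + j + o ≡ a + (o + j)
  assoc = trans (+-assoc a j o) (cong (a +_) (+-comm j o))
  lhs : ∀ c r x y → c * r * (x * y) ≡ c * (x * r * y)
  lhs = solve-∀
  rhs : ∀ c r x y → c * (x * (y * r)) ≡ c * r * (x * y)
  rhs = solve-∀

C-absorb : ∀ a o → ((a + o) C suc a) * suc a ≡ ((a + o) C a) * o
C-absorb a zero    = trans (cong (_* suc a) (k>n⇒nCk≡0 (s≤s (≤-reflexive (+-identityʳ a))))) (sym (*-zeroʳ ((a + 0) C a)))
C-absorb a (suc o) = subst₂ _≡_
  (cong₂ _*_ (cong₂ _C_ a+1+o (+-comm a 1)) (*-identityʳ (suc a)))
  (cong₂ _*_ (cong (_C a) a+1+o) (*-identityʳ (suc o))) (C-rise a 1 o)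
  where
  a+1+o : a + 1 + o ≡ a + suc o
  a+1+o = +-assoc a 1 o

C-pos : ∀ a b → 0 < (a + b) C a
C-pos a b with (a + b) C a in e
... | suc _ = s≤s z≤n
... | zero  = contradiction (sym (trans (sym (cong (_* (a ! * b !)) e)) (C-factorial a b))) (≢-nonZero⁻¹ _ {{(a + b) !≢0}})

C-monoˡ : ∀ n k → n C k ≤ suc n C k
C-monoˡ n zero    = ≤-refl
C-monoˡ n (suc k) = subst (n C suc k ≤_) (nCk+nC[k+1]≡[n+1]C[k+1] n k) (m≤n+m _ _)

C-mono-≤ : ∀ {m n} k → m ≤ n → m C k ≤ n C k
C-mono-≤ {m} k m≤n with m≤n⇒∃[o]m+o≡n m≤n
... | o , refl = go o
  where
  go : ∀ o → m C k ≤ (m + o) C k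
  go zero    = ≤-reflexive (cong (_C k) (sym (+-identityʳ m)))
  go (suc o) = ≤-trans (go o) (≤-trans (C-monoˡ (m + o) k) (≤-reflexive (cong (_C k) (sym (+-suc m o)))))

cnt≤C : ∀ {k} (P : Fam n) → Uniform k P → cnt P ≤ n C k
cnt≤C {zero}  {zero}  P uni = 𝟙≤1 (P [])
cnt≤C {zero}  {suc k} P uni = ≤-trans (≤-reflexive (cnt-oversize P uni (s≤s z≤n))) z≤n
cnt≤C {suc n} {zero}  P uni =
  +-mono-≤ (cnt≤C (P ∘ (outside ∷_)) (Uniform-out P uni))
    (≤-reflexive (cnt-empty {P = P ∘ (inside ∷_)} λ v v∈ → 1+n≢0 (uni (inside ∷ v) v∈)))
cnt≤C {suc n} {suc k} P uni = begin
  cnt (P ∘ (outside ∷_)) + cnt (P ∘ (inside ∷_)) ≤⟨ +-mono-≤ (cnt≤C _ (Uniform-out P uni)) (cnt≤C _ (Uniform-in P uni)) ⟩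
  n C suc k + n C k                               ≡⟨ +-comm (n C suc k) _ ⟩
  n C k + n C suc k                               ≡⟨ nCk+nC[k+1]≡[n+1]C[k+1] n k ⟩
  suc n C suc k                                   ∎
  where open ≤-Reasoning

-- Factor by factor, (b + δ) a ≤ b (a + δ) ≤ b c; the hypotheses survive when a, b and c grow by 1.
rise-ratio : ∀ j {a b c} δ → a ≤ b → a + δ ≤ c → rise (b + δ) j * rise a j ≤ rise b j * rise c j
rise-ratio zero    δ a≤b a+δ≤c = ≤-refl
rise-ratio (suc j) {a} {b} {c} δ a≤b a+δ≤c = begin
  (b + δ) * rise (suc b + δ) j * (a * rise (suc a) j) ≡⟨ interchange (b + δ) _ a _ ⟩
  (b + δ) * a * (rise (suc b + δ) j * rise (suc a) j) ≤⟨ *-mono-≤ factor (rise-ratio j δ (s≤s a≤b) (s≤s a+δ≤c)) ⟩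
  b * c * (rise (suc b) j * rise (suc c) j)           ≡⟨ interchange b c (rise (suc b) j) _ ⟩
  b * rise (suc b) j * (c * rise (suc c) j)           ∎
  where
  open ≤-Reasoning
  interchange : ∀ w x y z → w * x * (y * z) ≡ w * y * (x * z)
  interchange = solve-∀
  expand : ∀ a b δ → (b + δ) * a ≡ b * a + a * δ
  expand = solve-∀
  factor : (b + δ) * a ≤ b * c
  factor = begin
    (b + δ) * a   ≡⟨ expand a b δ ⟩
    b * a + a * δ ≤⟨ +-monoʳ-≤ (b * a) (*-monoˡ-≤ δ a≤b) ⟩
    b * a + b * δ ≡⟨ *-distribˡ-+ b a δ ⟨
    b * (a + δ)   ≤⟨ *-monoʳ-≤ b a+δ≤c ⟩
    b * c         ∎

rise-mono : ∀ j {a b} → a ≤ b → rise a j ≤ rise b j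
rise-mono zero    a≤b = ≤-refl
rise-mono (suc j) a≤b = *-mono-≤ a≤b (rise-mono j (s≤s a≤b))

Hit? : {Q : ℕ → ℕ → Set} → (∀ n k → Dec (Q n k)) → (v : Subset n) → Dec (Hit Q v)
Hit? Q? [] with Q? 0 0
... | yes q = yes (here q)
... | no ¬q = no λ { (here q) → ¬q q }
Hit? {suc n} Q? (b ∷ v) with Q? (suc n) ∣ b ∷ v ∣ | Hit? Q? v
... | yes q | _     = yes (here q)
... | no _  | yes h = yes (there h)
... | no ¬q | no ¬h = no λ { (here q) → ¬q q ; (there h) → ¬h h }

-- The members inside [M], as a family on [M]: the N largest elements are absent.
low : ∀ N {M} → Fam (N + M) → Fam M
low zero    P = P
low (suc N) P = low N (P ∘ (outside ∷_))

low-uniform : ∀ N {M k} (P : Fam (N + M)) → Uniform k P → Uniform k (low N P)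
low-uniform zero    P uni = uni
low-uniform (suc N) P uni = low-uniform N (P ∘ (outside ∷_)) (Uniform-out P uni)

∣v∣≤∣∷∣ : ∀ b (v : Subset n) → ∣ v ∣ ≤ ∣ b ∷ v ∣
∣v∣≤∣∷∣ inside  v = n≤1+n _
∣v∣≤∣∷∣ outside v = ≤-refl

-- `rise-ratio` is applied with s - 1 and τ + 2. Returning from the rising factorial of s - 1 to
-- that of s + 1 brings the factor (s - 1 + j)(s + j) / ((s - 1) s), which is at least (s + 2 j) /
-- s.
far-gain : ∀ s τ j a o → o + 2 ≤ s → o + (τ + 2) ≤ a →
  rise (suc (s + τ)) j * (s + 2 * j) * rise (suc o) j ≤ rise (suc s) j * s * rise (suc a) j
far-gain zero τ j a o le far = contradiction (≤-trans (m≤n+m 2 o) le) λ ()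
far-gain (suc zero) τ j a o le far = contradiction (≤-trans (m≤n+m 2 o) le) λ { (s≤s ()) }
far-gain (suc (suc b)) τ j a o le far = *-cancelˡ-≤ (suc b) (begin
  suc b * (rise (suc (suc (suc b) + τ)) j * (suc (suc b) + 2 * j) * rise (suc o) j)
    ≡⟨ cong (λ x → suc b * (rise x j * (suc (suc b) + 2 * j) * rise (suc o) j)) (eq₀ b τ) ⟩
  suc b * (rise (suc b + (2 + τ)) j * (suc (suc b) + 2 * j) * rise (suc o) j)
    ≡⟨ eq₁ b j (rise (suc b + (2 + τ)) j) (rise (suc o) j) ⟩
  suc b * (suc (suc b) + 2 * j) * (rise (suc b + (2 + τ)) j * rise (suc o) j)
    ≤⟨ *-mono-≤ gain (rise-ratio j (2 + τ) o≤ a≥) ⟩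
  (suc b + j) * (suc (suc b) + j) * (rise (suc b) j * rise (suc a) j)
    ≡⟨ eq₂ (suc b + j) (suc (suc b) + j) (rise (suc b) j) (rise (suc a) j) ⟩
  rise (suc b) j * (suc b + j) * (suc (suc b) + j) * rise (suc a) j
    ≡⟨ cong (λ x → x * (suc (suc b) + j) * rise (suc a) j) (rise-suc (suc b) j) ⟨
  suc b * rise (suc (suc b)) j * (suc (suc b) + j) * rise (suc a) j
    ≡⟨ cong (_* rise (suc a) j) (*-assoc (suc b) (rise (suc (suc b)) j) _) ⟩
  suc b * (rise (suc (suc b)) j * (suc (suc b) + j)) * rise (suc a) j
    ≡⟨ cong (λ x → suc b * x * rise (suc a) j) (rise-suc (suc (suc b)) j) ⟨
  suc b * (suc (suc b) * rise (suc (suc (suc b))) j) * rise (suc a) j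
    ≡⟨ eq₃ (suc b) (suc (suc b)) (rise (suc (suc (suc b))) j) (rise (suc a) j) ⟩
  suc b * (rise (suc (suc (suc b))) j * suc (suc b) * rise (suc a) j) ∎)
  where
  open ≤-Reasoning
  eq₀ : ∀ b τ → suc (suc (suc b) + τ) ≡ suc b + (2 + τ)
  eq₀ = solve-∀
  eq₁ : ∀ b j x y → suc b * (x * (suc (suc b) + 2 * j) * y) ≡ suc b * (suc (suc b) + 2 * j) * (x * y)
  eq₁ = solve-∀
  eq₂ : ∀ x y z w → x * y * (z * w) ≡ z * x * y * w
  eq₂ = solve-∀
  eq₃ : ∀ x y z w → x * (y * z) * w ≡ x * (z * y * w)
  eq₃ = solve-∀
  gain-eq : ∀ b j → (suc b + j) * (suc (suc b) + j) ≡ suc b * (suc (suc b) + 2 * j) + (j + j * j)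
  gain-eq = solve-∀
  gain : suc b * (suc (suc b) + 2 * j) ≤ (suc b + j) * (suc (suc b) + j)
  gain = ≤-trans (m≤m+n _ (j + j * j)) (≤-reflexive (sym (gain-eq b j)))
  o≤ : suc o ≤ suc b
  o≤ = s≤s⁻¹ (≤-trans (≤-reflexive (+-comm 2 o)) le)
  a≥ : suc o + (2 + τ) ≤ suc a
  a≥ = s≤s (≤-trans (≤-reflexive (cong (o +_) (+-comm 2 τ))) far)

-- The lines `Near` and `Far` and the ratios on them

module Parameters (s τ j : ℕ) where

  t k m M X Y : ℕ
  t = τ + j
  k = suc (s + t)
  m = s + t + s
  M = suc (suc m)
  X = rise (suc (s + τ)) j
  Y = rise (suc s) j

  -- The paper's t − j is τ, so k = s + 1 + t, M = 2k − t and m = M − 2; X / Y is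
  -- the asserted ratio.  Near e: [l] contains κ ≥ (l + t − e) / 2 elements and
  -- misses at most s.  Far e: it contains κ ≥ (l + t + 1 + e) / 2 elements and
  -- misses at most s − 1 − e.  The second case of FarOrLow says F ⊆ [M].
  Near Far FarOrLow : ℕ → ℕ → ℕ → Set
  Near e n κ = n + t ≤ κ + κ + e × n ≤ κ + s
  Far e n κ = n + t + suc e ≤ κ + κ × n + suc e ≤ κ + s
  FarOrLow e n κ = Far e n κ ⊎ (n ≤ M × k ≤ κ)

  Near? : ∀ e n κ → Dec (Near e n κ)
  Near? e n κ = (n + t ≤? κ + κ + e) ×-dec (n ≤? κ + s)

  Far? : ∀ e n κ → Dec (Far e n κ)
  Far? e n κ = (n + t + suc e ≤? κ + κ) ×-dec (n + suc e ≤? κ + s)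

  k+k≡M+t : k + k ≡ M + t
  k+k≡M+t = eq s t
    where
    eq : ∀ s t → suc (s + t) + suc (s + t) ≡ suc (suc (s + t + s)) + t
    eq = solve-∀

  low-bound : ∀ {n κ φ} → κ ≤ k → φ ≤ k → n + t ≤ κ + φ → n ≤ M
  low-bound κ≤k φ≤k le = +-cancelʳ-≤ t _ _ (≤-trans le (≤-trans (+-mono-≤ κ≤k φ≤k) (≤-reflexive k+k≡M+t)))

  -- If φ = k, the bound n + t ≤ 2k gives n ≤ M. Otherwise φ ≤ s + t forces n ≤ κ + s, so it is the
  -- other half of `Near` that fails: κ + κ + e < n + t. Adding this to n + t ≤ κ + φ and comparing
  -- with twice κ + φ gives `Far`.
  far-or-low : ∀ e n κ φ → κ ≤ k → φ ≤ k → n + t ≤ κ + φ → ¬ Near e n κ → FarOrLow e n φ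
  far-or-low e n κ φ κ≤k φ≤k le ¬near with k ≤? φ
  ... | yes k≤φ = inj₂ (low-bound κ≤k φ≤k le , k≤φ)
  ... | no  k≰φ = inj₁ (above , outs)
    where
    open ≤-Reasoning
    φ≤ : φ ≤ s + t
    φ≤ = s≤s⁻¹ (≰⇒> k≰φ)
    n≤ : n ≤ κ + s
    n≤ = +-cancelʳ-≤ t _ _ (≤-trans le (≤-trans (+-monoʳ-≤ κ φ≤) (≤-reflexive (sym (+-assoc κ s t)))))
    below : κ + κ + e < n + t
    below = ≰⇒> λ near → ¬near (near , n≤)
    eq₁ : ∀ x e κ → κ + κ + (x + suc e) ≡ suc (κ + κ + e) + x
    eq₁ = solve-∀
    eq₂ : ∀ κ φ → (κ + φ) + (κ + φ) ≡ κ + κ + (φ + φ)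
    eq₂ = solve-∀
    above : n + t + suc e ≤ φ + φ
    above = +-cancelˡ-≤ (κ + κ) _ _ (begin
      κ + κ + (n + t + suc e)      ≡⟨ eq₁ (n + t) e κ ⟩
      suc (κ + κ + e) + (n + t)    ≤⟨ +-mono-≤ (≤-trans below le) le ⟩
      (κ + φ) + (κ + φ)            ≡⟨ eq₂ κ φ ⟩
      κ + κ + (φ + φ)              ∎)
    outs : n + suc e ≤ φ + s
    outs = +-cancelʳ-≤ t _ _ (begin
      n + suc e + t   ≡⟨ eq₃ n (suc e) t ⟩
      n + t + suc e   ≤⟨ above ⟩
      φ + φ           ≤⟨ +-monoʳ-≤ φ φ≤ ⟩
      φ + (s + t)     ≡⟨ +-assoc φ s t ⟨
      φ + s + t       ∎)
      where
      eq₃ : ∀ a b c → a + b + c ≡ a + c + b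
      eq₃ = solve-∀

  meet⇒far-or-low : ∀ e {v w : Subset n} → ∣ v ∣ ≤ k → ∣ w ∣ ≤ k → Meet t v w → ¬ Hit (Near e) v → Hit (FarOrLow e) w
  meet⇒far-or-low e v≤ w≤ (here le) ¬hit = here (far-or-low e _ _ _ v≤ w≤ le (¬hit ∘ here))
  meet⇒far-or-low e v≤ w≤ (there {b = b} {c} {v} {w} mt) ¬hit =
    there (meet⇒far-or-low e (≤-trans (∣v∣≤∣∷∣ b v) v≤) (≤-trans (∣v∣≤∣∷∣ c w) w≤) mt (¬hit ∘ there))

  near-ratio : ∀ a o → Near 0 (a + j + o) (a + j) → X * rise (suc o) j ≤ Y * rise (suc a) j
  near-ratio a o (above , outs) = rise-ratio j τ (s≤s (+-cancelˡ-≤ (a + j) _ _ outs))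
    (s≤s (+-cancelˡ-≤ (a + j + j) _ _ (begin
      a + j + j + (o + τ)     ≡⟨ eq₁ a j o τ ⟩
      a + j + o + (τ + j)     ≤⟨ above ⟩
      a + j + (a + j) + 0     ≡⟨ eq₂ a j ⟩
      a + j + j + a           ∎)))
    where
    open ≤-Reasoning
    eq₁ : ∀ a j o τ → a + j + j + (o + τ) ≡ a + j + o + (τ + j)
    eq₁ = solve-∀
    eq₂ : ∀ a j → a + j + (a + j) + 0 ≡ a + j + j + a
    eq₂ = solve-∀

  far-above : ∀ e a o → Far e (a + j + o) (a + j) → o + (τ + suc e) ≤ a
  far-above e a o (above , _) = +-cancelˡ-≤ (a + j + j) _ _ (begin
    a + j + j + (o + (τ + suc e)) ≡⟨ eq₁ a j o τ (suc e) ⟩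
    a + j + o + (τ + j) + suc e   ≤⟨ above ⟩
    a + j + (a + j)               ≡⟨ eq₂ a j ⟩
    a + j + j + a                 ∎)
    where
    open ≤-Reasoning
    eq₁ : ∀ a j o τ e → a + j + j + (o + (τ + e)) ≡ a + j + o + (τ + j) + e
    eq₁ = solve-∀
    eq₂ : ∀ a j → a + j + (a + j) ≡ a + j + j + a
    eq₂ = solve-∀

  far-outs : ∀ e a o → Far e (a + j + o) (a + j) → o + suc e ≤ s
  far-outs e a o (_ , outs) = +-cancelˡ-≤ (a + j) _ _ (≤-trans (≤-reflexive (sym (+-assoc (a + j) o (suc e)))) outs)

  s*Y : s * Y ≡ rise s j * (s + j)
  s*Y = rise-suc s j

  -- Compared with `near-ratio`, one element fewer may be missing and a exceeds o by one more, so
  -- `rise-ratio` applies with s and τ + 1. The rising factorial of s is Y s / (s + j), hence the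
  -- gain (s + j) / s, written `s + 1 * j` to match `finish`.
  far-ratio₀ : ∀ a o → Far 0 (a + j + o) (a + j) → X * (s + 1 * j) * rise (suc o) j ≤ Y * s * rise (suc a) j
  far-ratio₀ a o far = begin
    X * (s + 1 * j) * rise (suc o) j           ≡⟨ eq₁ X s j (rise (suc o) j) ⟩
    (s + j) * (X * rise (suc o) j)             ≡⟨ cong (λ x → (s + j) * (rise x j * rise (suc o) j)) (+-suc s τ) ⟨
    (s + j) * (rise (s + suc τ) j * rise (suc o) j)
      ≤⟨ *-monoʳ-≤ (s + j) (rise-ratio j (suc τ) (≤-trans (≤-reflexive (+-comm 1 o)) (far-outs 0 a o far))
           (s≤s (≤-trans (≤-reflexive (cong (o +_) (+-comm 1 τ))) (far-above 0 a o far)))) ⟩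
    (s + j) * (rise s j * rise (suc a) j)      ≡⟨ eq₂ (s + j) (rise s j) _ ⟩
    rise s j * (s + j) * rise (suc a) j        ≡⟨ cong (_* rise (suc a) j) (trans (sym s*Y) (*-comm s Y)) ⟩
    Y * s * rise (suc a) j                     ∎
    where
    open ≤-Reasoning
    eq₁ : ∀ X s j r → X * (s + 1 * j) * r ≡ (s + j) * (X * r)
    eq₁ = solve-∀
    eq₂ : ∀ x y z → x * (y * z) ≡ y * x * z
    eq₂ = solve-∀

  far-ratio₁ : ∀ a o → Far 1 (a + j + o) (a + j) → X * (s + 2 * j) * rise (suc o) j ≤ Y * s * rise (suc a) j
  far-ratio₁ a o far = far-gain s τ j a o (far-outs 1 a o far) (far-above 1 a o far)

-- Balancing the members inside [M] against the others

finish : ∀ s a b q {f g h D X Y} → 0 < X →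
  let τ = suc a; j = suc b; k = suc (s + (τ + j)); W = (suc s + τ) * (suc s + j) in
  X * (s + suc q * j) * g + Y * s * h ≤ Y * s * D →
  X * (k * suc s) * f ≤ h * Y * W →
  s * τ * f ≤ suc q * W * g →
  τ * f ≤ g * suc (k + τ) →
  X * (f + g) ≤ Y * D
-- For s = 0 the right side of `gain` vanishes and forces g = 0; then f = 0 by the last hypothesis,
-- as τ > 0.
finish zero a b q {f} {g} {h} {D} {X} {Y} X>0 gain _ _ f≤g = ≤-trans (≤-reflexive X*[f+g]≡0) z≤n
  where
  Xqjg≤0 : X * (suc q * suc b) * g ≤ 0
  Xqjg≤0 = ≤-trans (m≤m+n _ (Y * 0 * h)) (≤-trans gain (≤-reflexive (cong (_* D) (*-zeroʳ Y))))
  g≡0 : g ≡ 0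
  g≡0 with m*n≡0⇒m≡0∨n≡0 (X * (suc q * suc b)) (n≤0⇒n≡0 Xqjg≤0)
  ... | inj₂ g≡0 = g≡0
  ... | inj₁ e with m*n≡0⇒m≡0∨n≡0 X e
  ...   | inj₁ X≡0 = contradiction (sym X≡0) (<⇒≢ X>0)
  f≡0 : f ≡ 0
  f≡0 = n≤0⇒n≡0 (≤-trans (m≤m+n f (a * f)) (≤-trans f≤g (≤-reflexive (cong (_* (suc (suc (suc a + suc b) + suc a))) g≡0))))
  X*[f+g]≡0 : X * (f + g) ≡ 0
  X*[f+g]≡0 = trans (cong₂ (λ x y → X * (x + y)) f≡0 g≡0) (*-zeroʳ X)
-- Here f and g count the members inside [M] and the others, h and D the shadows of the former and
-- of the whole family. As W = k (s + 1) + τ j, the former lack only the share τ j / W of the ratio,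
-- and the surplus (q + 1) j / s of the latter covers it.
finish (suc s′) a b q {f} {g} {h} {D} {X} {Y} X>0 gain lym q-ineq _ = *-cancelˡ-≤ (W * s) (begin
  W * s * (X * (f + g))                                       ≡⟨ eq₁ s′ a b f g X ⟩
  s * (X * (k * suc s) * f) + (X * s * g * W + X * j * (s * τ * f))
    ≤⟨ +-mono-≤ (*-monoʳ-≤ s lym) (+-monoʳ-≤ (X * s * g * W) (*-monoʳ-≤ (X * j) q-ineq)) ⟩
  s * (h * Y * W) + (X * s * g * W + X * j * (suc q * W * g)) ≡⟨ eq₂ s j W q g h X Y ⟩
  W * (X * (s + suc q * j) * g + Y * s * h)                   ≤⟨ *-monoʳ-≤ W gain ⟩
  W * (Y * s * D)                                             ≡⟨ eq₃ s W D Y ⟩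
  W * s * (Y * D)                                             ∎)
  where
  open ≤-Reasoning
  s τ j k W : ℕ
  s = suc s′
  τ = suc a
  j = suc b
  k = suc (s + (τ + j))
  W = (suc s + τ) * (suc s + j)
  eq₁ : ∀ s′ a b f g X → let s = suc s′; τ = suc a; j = suc b; k = suc (s + (τ + j)); W = (suc s + τ) * (suc s + j) in
    W * s * (X * (f + g)) ≡ s * (X * (k * suc s) * f) + (X * s * g * W + X * j * (s * τ * f))
  eq₁ = solve-∀
  eq₂ : ∀ s j W q g h X Y → s * (h * Y * W) + (X * s * g * W + X * j * (suc q * W * g))
    ≡ W * (X * (s + suc q * j) * g + Y * s * h)
  eq₂ = solve-∀
  eq₃ : ∀ s W D Y → W * (Y * s * D) ≡ W * s * (Y * D)
  eq₃ = solve-∀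

-- Follows from s (k + τ + 1) ≤ 2 W, the difference being the polynomial added in the chain.
double-gain : ∀ s τ j {f g} → let k = suc (s + (τ + j)); W = (suc s + τ) * (suc s + j) in
  τ * f ≤ g * suc (k + τ) → s * τ * f ≤ 2 * W * g
double-gain s τ j {f} {g} f≤g = begin
  s * τ * f                        ≡⟨ *-assoc s τ f ⟩
  s * (τ * f)                      ≤⟨ *-monoʳ-≤ s f≤g ⟩
  s * (g * suc (k + τ))            ≤⟨ m≤m+n _ _ ⟩
  s * (g * suc (k + τ)) + (s * s + 2 * s + s * j + 2 * ((1 + τ) * (1 + j))) * g ≡⟨ eq₁ s τ j g ⟨
  2 * W * g                        ∎
  where
  open ≤-Reasoning
  k W : ℕ
  k = suc (s + (τ + j))
  W = (suc s + τ) * (suc s + j)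
  eq₁ : ∀ s τ j g → 2 * ((suc s + τ) * (suc s + j)) * g
    ≡ s * (g * (suc (suc (s + (τ + j)) + τ))) + (s * s + 2 * s + s * j + 2 * ((1 + τ) * (1 + j))) * g
  eq₁ = solve-∀

-- With τ = a + 1 and j = b + 1 the difference of the two sides is a polynomial in s, a, b with
-- nonnegative coefficients, given below in Horner form.
gain-polynomial : ∀ s a b → let τ = suc a; j = suc b; k = suc (s + (τ + j)); W = (suc s + τ) * (suc s + j) in
  (s + 3 * k) * suc s * suc (k + τ) * (W + s * τ) ≤ W * ((k + s) * suc (k + s)) * (suc (k + τ) + τ)
gain-polynomial s a b = ≤-trans (m≤m+n _ _) (≤-reflexive (sym (expansion s a b)))
  where
  expansion : ∀ s a b → let τ = suc a; j = suc b; k = suc (s + (τ + j)); W = (suc s + τ) * (suc s + j) in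
    W * ((k + s) * suc (k + s)) * (suc (k + τ) + τ) ≡ (s + 3 * k) * suc s * suc (k + τ) * (W + s * τ) +
    (108 + b * (174 + b * (100 + b * (24 + b * 2)))
      + a * (234 + b * (301 + b * (132 + b * (22 + b * 1))) + a * (174 + b * (177 + b * (55 + b * 5)) + a * (54 + b * (41 + b * 7) + a * (6 + b * 3))))
      + s * (151 + b * (223 + b * (103 + b * (18 + b * 1)))
      + a * (289 + b * (310 + b * (94 + b * 8)) + a * (176 + b * (132 + b * 21) + a * (41 + b * 17 + a * 3)))
      + s * (61 + b * (91 + b * (31 + b * 3))
      + a * (95 + b * (87 + b * 14) + a * (38 + b * 19 + a * 4))
      + s * (9 + b * (16 + b * 3) + a * (10 + b * 8 + a * 1)
      + s * (1 + b * 1 + a * 1)))))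
  expansion = solve-∀

-- The claim amounts to (W + s τ) f ≤ W (f + g). Bounding f from above and f + g from below, both in
-- terms of u, leaves `gain-polynomial`.
single-gain : ∀ s a b {f g u B} → let τ = suc a; j = suc b; k = suc (s + (τ + j)); W = (suc s + τ) * (suc s + j) in
  f * k ≤ u * (s + 3 * k) → B * (k * suc s) ≡ u * ((k + s) * suc (k + s)) →
  B * (suc (k + τ) + τ) ≤ (f + g) * suc (k + τ) → s * τ * f ≤ 1 * W * g
single-gain s a b {f} {g} {u} {B} f≤ B≡ large = *-cancelˡ-≤ (k * suc s * K)
  (+-cancelˡ-≤ (k * suc s * K * (W * f)) _ _ (begin
    k * suc s * K * (W * f) + k * suc s * K * (s * τ * f) ≡⟨ eq₁ k s K W f τ ⟩
    f * k * (suc s * K * (W + s * τ))                   ≤⟨ *-monoˡ-≤ (suc s * K * (W + s * τ)) f≤ ⟩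
    u * (s + 3 * k) * (suc s * K * (W + s * τ))         ≡⟨ eq₂ u (s + 3 * k) (suc s) K (W + s * τ) ⟩
    u * ((s + 3 * k) * suc s * K * (W + s * τ))         ≤⟨ *-monoʳ-≤ u (gain-polynomial s a b) ⟩
    u * (W * ((k + s) * suc (k + s)) * (K + τ))         ≡⟨ eq₃ u W ((k + s) * suc (k + s)) (K + τ) ⟩
    u * ((k + s) * suc (k + s)) * (W * (K + τ))         ≡⟨ cong (_* (W * (K + τ))) B≡ ⟨
    B * (k * suc s) * (W * (K + τ))                     ≡⟨ eq₄ B (k * suc s) W (K + τ) ⟩
    k * suc s * W * (B * (K + τ))                       ≤⟨ *-monoʳ-≤ (k * suc s * W) large ⟩
    k * suc s * W * ((f + g) * K)                       ≡⟨ eq₅ (k * suc s) W f g K ⟩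
    k * suc s * K * (W * f) + k * suc s * K * (1 * W * g) ∎))
  where
  open ≤-Reasoning
  τ j k W K : ℕ
  τ = suc a
  j = suc b
  k = suc (s + (τ + j))
  W = (suc s + τ) * (suc s + j)
  K = suc (k + τ)
  eq₁ : ∀ k s K W f τ → k * suc s * K * (W * f) + k * suc s * K * (s * τ * f) ≡ f * k * (suc s * K * (W + s * τ))
  eq₁ = solve-∀
  eq₂ : ∀ u x y K z → u * x * (y * K * z) ≡ u * (x * y * K * z)
  eq₂ = solve-∀
  eq₃ : ∀ u W x y → u * (W * x * y) ≡ u * x * (W * y)
  eq₃ = solve-∀
  eq₄ : ∀ B x W y → B * x * (W * y) ≡ x * W * (B * y)
  eq₄ = solve-∀
  eq₅ : ∀ x W f g K → x * W * ((f + g) * K) ≡ x * K * (W * f) + x * K * (1 * W * g)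
  eq₅ = solve-∀

-- The inequality for the parametrized family

module Core (s a b : ℕ) where

  τ j : ℕ
  τ = suc a
  j = suc b

  open Parameters s τ j

  -- At a length above M at most k elements satisfy neither alternative, since 2k = M + t.
  far-or-low-tail : ∀ e {N c} {v : Subset (N + M)} → ∣ c ∷ v ∣ ≤ k → Hit (FarOrLow e) (c ∷ v) → Hit (FarOrLow e) v
  far-or-low-tail e {N} size (here (inj₁ (above , _))) = contradiction (begin
    suc (N + M) + t            ≤⟨ m≤m+n _ (suc e) ⟩
    suc (N + M) + t + suc e    ≤⟨ above ⟩
    _                          ≤⟨ +-mono-≤ size size ⟩
    k + k                      ≡⟨ k+k≡M+t ⟩
    M + t                      ∎) (<⇒≱ (+-monoˡ-< t (s≤s (m≤n+m M N))))
    where open ≤-Reasoning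
  far-or-low-tail e {N} size (here (inj₂ (le , _))) = contradiction le (<⇒≱ (s≤s (m≤n+m M N)))
  far-or-low-tail e size (there h) = h

  small⇒far : ∀ e {v : Subset n} → ∣ v ∣ < k → Hit (FarOrLow e) v → Hit (Far e) v
  small⇒far e size (here (inj₁ far))       = here far
  small⇒far e size (here (inj₂ (_ , k≤)))  = contradiction k≤ (<⇒≱ size)
  small⇒far e size (there {b = c} {v} h) = there (small⇒far e (≤-<-trans (∣v∣≤∣∷∣ c v) size) h)

  -- The g members not inside [M] are sorted by their largest element. Without it fewer than k
  -- elements remain, so they hit the line of `Far` and the bound `far` applies; the classes have
  -- disjoint shadows.
  high-part : ∀ e A B →
    (∀ {n κ} (P : Fam n) → Uniform κ P → (∀ v → T (P v) → Hit (Far e) v) → A * cnt P ≤ B * cnt (shadow j P)) →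
    ∀ N (P : Fam (N + M)) → Uniform k P → (∀ v → T (P v) → Hit (FarOrLow e) v) →
    ∃ λ g → cnt P ≡ cnt (low N P) + g × A * g + B * cnt (shadow j (low N P)) ≤ B * cnt (shadow j P)
  high-part e A B far zero P uni hit =
    0 , sym (+-identityʳ (cnt P)) , ≤-reflexive (cong (_+ B * cnt (shadow j P)) (*-zeroʳ A))
  high-part e A B far (suc N) P uni hit
    with high-part e A B far N (P ∘ (outside ∷_)) (Uniform-out P uni)
           (λ v v∈P → far-or-low-tail e {c = outside} (≤-reflexive (uni _ v∈P)) (hit _ v∈P))
  ... | g , size , ineq = g + cnt P₁ , size′ , (begin
    A * (g + cnt P₁) + B * h                       ≡⟨ eq A g (cnt P₁) (B * h) ⟩
    A * g + B * h + A * cnt P₁                     ≤⟨ +-mono-≤ ineq (far P₁ (Uniform-in P uni) hit₁) ⟩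
    B * cnt (shadow j P₀) + B * cnt (shadow j P₁)  ≡⟨ *-distribˡ-+ B (cnt (shadow j P₀)) _ ⟨
    B * (cnt (shadow j P₀) + cnt (shadow j P₁))    ≤⟨ *-monoʳ-≤ B (shadow-split j P) ⟩
    B * cnt (shadow j P)                           ∎)
    where
    open ≤-Reasoning
    P₀ P₁ : Fam (N + M)
    P₀ = P ∘ (outside ∷_)
    P₁ = P ∘ (inside ∷_)
    h = cnt (shadow j (low N P₀))
    size′ : cnt P₀ + cnt P₁ ≡ cnt (low N P₀) + (g + cnt P₁)
    size′ = trans (cong (_+ cnt P₁) size) (+-assoc (cnt (low N P₀)) g _)
    hit₁ : ∀ v → T (P₁ v) → Hit (Far e) v
    hit₁ v v∈P = small⇒far e (≤-reflexive (uni _ v∈P)) (far-or-low-tail e {c = inside} (≤-reflexive (uni _ v∈P)) (hit _ v∈P))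
    eq : ∀ A g c x → A * (g + c) + x ≡ A * g + x + A * c
    eq = solve-∀

  near-tail : ∀ e {c} {v : Subset n} → ∣ c ∷ v ∣ + s ≤ n → Hit (Near e) (c ∷ v) → Hit (Near e) v
  near-tail e le (here (_ , outs)) = contradiction outs (<⇒≱ (s≤s le))
  near-tail e le (there h)         = h

  low-near : ∀ e N (P : Fam (N + M)) → Uniform k P → (∀ v → T (P v) → Hit (Near e) v) →
    ∀ v → T (low N P v) → Hit (Near e) v
  low-near e zero    P uni hit = hit
  low-near e (suc N) P uni hit = low-near e N (P ∘ (outside ∷_)) (Uniform-out P uni) λ v v∈P →
    near-tail e {c = outside} (≤-trans (≤-reflexive (cong (_+ s) (uni _ v∈P))) (≤-trans (n≤1+n (k + s)) (m≤n+m M N))) (hit _ v∈P)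

  t′ : ℕ
  t′ = a + j

  t′≤near₁ : ∀ n κ → κ ≤ n → Near 1 n κ → t′ ≤ κ
  t′≤near₁ n κ κ≤n (above , _) = s≤s⁻¹ (+-cancelˡ-≤ κ _ _ (≤-trans (+-monoˡ-≤ t κ≤n)
    (≤-trans above (≤-reflexive (trans (+-assoc κ κ 1) (cong (κ +_) (+-comm κ 1)))))))
  -- With `t′` = t - 1, the line of `Near 1` says that a set still has at least as many elements as
  -- it misses after losing `t′` of them: o ≤ x. So the `t′`-th shadow is not smaller.
  near₁-ratio : ∀ x o → Near 1 (x + t′ + o) (x + t′) → 1 * rise (suc o) t′ ≤ 1 * rise (suc x) t′
  near₁-ratio x o (above , _) = *-monoʳ-≤ 1 (rise-mono t′ (s≤s (+-cancelʳ-≤ (suc (x + t′ + t′)) _ _ (begin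
    o + suc (x + t′ + t′)     ≡⟨ eq₁ x t′ o ⟩
    x + t′ + o + suc t′       ≤⟨ above ⟩
    x + t′ + (x + t′) + 1     ≡⟨ eq₂ x t′ ⟩
    x + suc (x + t′ + t′)     ∎))))
    where
    open ≤-Reasoning
    eq₁ : ∀ x t o → o + suc (x + t + t) ≡ x + t + o + suc t
    eq₁ = solve-∀
    eq₂ : ∀ x t → x + t + (x + t) + 1 ≡ x + suc (x + t + t)
    eq₂ = solve-∀

  module Near₁ = Block (Near 1) (Near? 1) 1 1 t′ t′≤near₁ near₁-ratio

  s+t : s + t ≡ suc (s + t′)
  s+t = +-suc s t′

  u : ℕ
  u = m C (s + t)

  -- The t′-th shadow is at least as large as P, and it consists of s-sets: this
  -- replaces the reflection principle.
  near-count : (P : Fam m) → Uniform (s + t′) P → (∀ v → T (P v) → Hit (Near 1) v) → cnt P ≤ u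
  near-count P uni hit = begin
    cnt P                       ≡⟨ *-identityˡ (cnt P) ⟨
    1 * cnt P                   ≤⟨ Near₁.block P uni hit ⟩
    1 * cnt (shadow t′ P)       ≡⟨ *-identityˡ _ ⟩
    cnt (shadow t′ P)           ≤⟨ cnt≤C (shadow t′ P) (shadow-uniform {k = s} t′ P uni) ⟩
    m C s                       ≡⟨ nCk≡nC[n∸k] (m≤n+m s (s + t)) ⟩
    m C (m ∸ s)                 ≡⟨ cong (m C_) (m+n∸n≡m (s + t) s) ⟩
    u                           ∎
    where open ≤-Reasoning

  mCk*k : (m C k) * k ≡ u * s
  mCk*k = C-absorb (s + t) s

  -- The members are split by the two largest elements of [M]. Those with neither number at most
  -- C(m, k), those with exactly one at most 2 u, and those with both at most u by `near-count`.
  low-count : (P : Fam M) → Uniform k P → (∀ v → T (P v) → Hit (Near 1) v) → cnt P * k ≤ u * (s + 3 * k)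
  low-count P uni hit = begin
    cnt P * k                          ≤⟨ *-monoˡ-≤ k count ⟩
    ((m C k + u) + (u + u)) * k        ≡⟨ eq₁ (m C k) u k ⟩
    (m C k) * k + u * (3 * k)          ≡⟨ cong (_+ u * (3 * k)) mCk*k ⟩
    u * s + u * (3 * k)                ≡⟨ *-distribˡ-+ u s (3 * k) ⟨
    u * (s + 3 * k)                    ∎
    where
    open ≤-Reasoning
    P₀ P₁ : Fam (suc m)
    P₀ = P ∘ (outside ∷_)
    P₁ = P ∘ (inside ∷_)
    eq₁ : ∀ x u k → ((x + u) + (u + u)) * k ≡ x * k + u * (3 * k)
    eq₁ = solve-∀
    uni₁₁ : Uniform (s + t′) (P₁ ∘ (inside ∷_))
    uni₁₁ v v∈P = suc-injective (trans (suc-injective (uni _ v∈P)) s+t)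
    hit₁₁ : ∀ v → T (P (inside ∷ inside ∷ v)) → Hit (Near 1) v
    -- At the lengths M and M - 1 the set misses s + 1 elements, one too many, so the line is hit
    -- within [m].
    hit₁₁ v v∈P = near-tail 1 {c = inside} (≤-reflexive (cong (λ x → pred x + s) (uni _ v∈P)))
      (near-tail 1 {c = inside} (≤-reflexive (cong (_+ s) (uni _ v∈P))) (hit _ v∈P))
    count : cnt P ≤ (m C k + u) + (u + u)
    count = +-mono-≤
      (+-mono-≤ (cnt≤C (P₀ ∘ (outside ∷_)) (Uniform-out P₀ (Uniform-out P uni)))
                (cnt≤C (P₀ ∘ (inside ∷_)) (Uniform-in P₀ (Uniform-out P uni))))
      (+-mono-≤ (cnt≤C (P₁ ∘ (outside ∷_)) (Uniform-out P₁ (Uniform-in P uni)))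
                (near-count (P₁ ∘ (inside ∷_)) uni₁₁ hit₁₁))

  -- Pascal's rule, used twice, expands C(M, k) into u and its two neighbours C(m, k - 2) and C(m,
  -- k), which absorption expresses through u.
  MCk : (M C k) * (k * suc s) ≡ u * ((k + s) * suc (k + s))
  MCk = begin
    (M C k) * (k * suc s)
      ≡⟨ cong (_* (k * suc s)) pascal ⟩
    ((x + u) + (u + m C k)) * (k * suc s)
      ≡⟨ eq₁ x u (m C k) k s ⟩
    k * (x * suc s) + (2 * u * (k * suc s) + suc s * ((m C k) * k))
      ≡⟨ cong₂ (λ y z → k * y + (2 * u * (k * suc s) + suc s * z)) absorb mCk*k ⟩
    k * (u * (s + t)) + (2 * u * (k * suc s) + suc s * (u * s))
      ≡⟨ eq₂ s t u ⟩
    u * ((k + s) * suc (k + s)) ∎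
    where
    open ≡-Reasoning
    x = m C (s + t′)
    m≡ : m ≡ s + t′ + suc s
    m≡ = trans (cong (_+ s) s+t) (sym (+-suc (s + t′) s))
    pascal : M C k ≡ (x + u) + (u + m C k)
    pascal = begin
      M C k                                    ≡⟨ nCk+nC[k+1]≡[n+1]C[k+1] (suc m) (s + t) ⟨
      suc m C (s + t) + suc m C k              ≡⟨ cong₂ _+_ (cong (suc m C_) s+t) refl ⟩
      suc m C suc (s + t′) + suc m C k         ≡⟨ cong₂ _+_ (nCk+nC[k+1]≡[n+1]C[k+1] m (s + t′)) (nCk+nC[k+1]≡[n+1]C[k+1] m (s + t)) ⟨
      (x + m C suc (s + t′)) + (u + m C k)     ≡⟨ cong (λ y → (x + m C y) + (u + m C k)) s+t ⟨
      (x + u) + (u + m C k)                    ∎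
    absorb : x * suc s ≡ u * (s + t)
    absorb = begin
      x * suc s                                       ≡⟨ cong (λ y → (y C (s + t′)) * suc s) m≡ ⟩
      ((s + t′ + suc s) C (s + t′)) * suc s           ≡⟨ C-absorb (s + t′) (suc s) ⟨
      ((s + t′ + suc s) C suc (s + t′)) * suc (s + t′) ≡⟨ cong₂ (λ y z → (y C z) * z) m≡ s+t ⟨
      u * (s + t)                                     ∎
    eq₁ : ∀ x u y k s → ((x + u) + (u + y)) * (k * suc s) ≡ k * (x * suc s) + (2 * u * (k * suc s) + suc s * (y * k))
    eq₁ = solve-∀
    eq₂ : ∀ s t u → let k = suc (s + t) in
      k * (u * (s + t)) + (2 * u * (k * suc s) + suc s * (u * s)) ≡ u * ((k + s) * suc (k + s))
    eq₂ = solve-∀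

  j≤near : ∀ n κ → κ ≤ n → Near 0 n κ → j ≤ κ
  j≤near n κ κ≤n (above , _) = ≤-trans (m≤n+m j τ) (+-cancelˡ-≤ κ _ _
    (≤-trans (+-monoˡ-≤ t κ≤n) (≤-trans above (≤-reflexive (+-identityʳ (κ + κ))))))

  j≤far : ∀ e n κ → κ ≤ n → Far e n κ → j ≤ κ
  j≤far e n κ κ≤n (above , _) = ≤-trans (m≤n+m j τ) (+-cancelˡ-≤ κ _ _
    (≤-trans (+-monoˡ-≤ t κ≤n) (≤-trans (m≤m+n (n + t) (suc e)) above)))

  module Near₀ = Block (Near 0) (Near? 0) X Y j j≤near near-ratio
  module Far₀ = Block (Far 0) (Far? 0) (X * (s + 1 * j)) (Y * s) j (j≤far 0) far-ratio₀
  module Far₁ = Block (Far 1) (Far? 1) (X * (s + 2 * j)) (Y * s) j (j≤far 1) far-ratio₁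

  W : ℕ
  W = (suc s + τ) * (suc s + j)

  -- Local LYM on [M] involves the rising factorials of s + τ + 2 and s + 2. Moving each down by one
  -- with `rise-suc` yields X and Y and the correction k (s + 1) / W.
  low-LYM : (P : Fam M) → Uniform k P → X * (k * suc s) * cnt P ≤ cnt (shadow j P) * Y * W
  low-LYM P uni = begin
    X * (k * suc s) * f                                ≡⟨ cong (λ z → X * (z * suc s) * f) k≡ ⟩
    X * ((suc (s + τ) + j) * suc s) * f                ≡⟨ eq₁ X (suc (s + τ) + j) (suc s) f ⟩
    suc s * f * (X * (suc (s + τ) + j))                ≡⟨ cong (suc s * f *_) (rise-suc (suc (s + τ)) j) ⟨
    suc s * f * (suc (s + τ) * rise (2 + (s + τ)) j)   ≡⟨ eq₂ (suc s) f (suc (s + τ)) _ ⟩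
    suc s * suc (s + τ) * (f * rise (2 + (s + τ)) j)   ≤⟨ *-monoʳ-≤ (suc s * suc (s + τ)) (local-LYM j P (subst (λ z → Uniform z P) k≡ uni) M≡) ⟩
    suc s * suc (s + τ) * (h * rise (2 + s) j)         ≡⟨ eq₃ (suc s) (suc (s + τ)) h _ ⟩
    h * suc (s + τ) * (suc s * rise (2 + s) j)         ≡⟨ cong (h * suc (s + τ) *_) (rise-suc (suc s) j) ⟩
    h * suc (s + τ) * (Y * (suc s + j))                ≡⟨ eq₄ h (suc (s + τ)) Y (suc s + j) ⟩
    h * Y * W                                          ∎
    where
    open ≤-Reasoning
    f h : ℕ
    f = cnt P
    h = cnt (shadow j P)
    k≡ : k ≡ suc (s + τ) + j
    k≡ = cong suc (sym (+-assoc s τ j))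
    M≡ : M ≡ suc (s + τ) + j + suc s
    M≡ = trans (cong (λ z → suc (z + s)) k≡) (sym (+-suc (suc (s + τ) + j) s))
    eq₁ : ∀ X x y f → X * (x * y) * f ≡ y * f * (X * x)
    eq₁ = solve-∀
    eq₂ : ∀ x f y z → x * f * (y * z) ≡ x * y * (f * z)
    eq₂ = solve-∀
    eq₃ : ∀ x y h z → x * y * (h * z) ≡ h * y * (x * z)
    eq₃ = solve-∀
    eq₄ : ∀ h x Y y → h * x * (Y * y) ≡ h * Y * (x * y)
    eq₄ = solve-∀

  -- The assumption on the size with its denominator cleared: k + t + 1 - j is `suc (k + τ)` and t -
  -- j is τ.
  Large : ℕ → Set
  Large c = (M C k) * (suc (k + τ) + τ) ≤ c * suc (k + τ)

  τ*f≤g*K : ∀ {f g} → f ≤ M C k → Large (f + g) → τ * f ≤ g * suc (k + τ)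
  τ*f≤g*K {f} {g} f≤ large = +-cancelˡ-≤ (f * suc (k + τ)) _ _ (begin
    f * suc (k + τ) + τ * f          ≡⟨ cong (f * suc (k + τ) +_) (*-comm τ f) ⟩
    f * suc (k + τ) + f * τ          ≡⟨ *-distribˡ-+ f (suc (k + τ)) τ ⟨
    f * (suc (k + τ) + τ)            ≤⟨ *-monoˡ-≤ (suc (k + τ) + τ) f≤ ⟩
    (M C k) * (suc (k + τ) + τ)      ≤⟨ large ⟩
    (f + g) * suc (k + τ)            ≡⟨ *-distribʳ-+ (suc (k + τ)) f g ⟩
    f * suc (k + τ) + g * suc (k + τ) ∎)
    where open ≤-Reasoning

  -- On fewer than M points there are at most C(M, k) sets of size k, fewer than the assumed size
  -- because τ > 0.
  M≤n : (P : Fam n) → Uniform k P → Large (cnt P) → M ≤ n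
  M≤n {n} P uni large with M ≤? n
  ... | yes M≤n = M≤n
  ... | no  M≰n = contradiction large (<⇒≱ (begin-strict
    cnt P * suc (k + τ)            ≤⟨ *-monoˡ-≤ (suc (k + τ)) (≤-trans (cnt≤C P uni) (C-mono-≤ k (<⇒≤ (≰⇒> M≰n)))) ⟩
    (M C k) * suc (k + τ)          <⟨ *-monoʳ-< (M C k) {{>-nonZero (subst (λ z → 0 < z C k) (+-suc k s) (C-pos k (suc s)))}} (m<m+n (suc (k + τ)) (s≤s z≤n)) ⟩
    (M C k) * (suc (k + τ) + τ)    ∎))
    where open ≤-Reasoning

  Conclusion : Fam n → Set
  Conclusion P = X * cnt P ≤ Y * cnt (shadow j P)

  ¬Hit-or-all : ∀ {Q} → (∀ n κ → Dec (Q n κ)) → (P : Fam n) →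
    (∃ λ v → T (P v) × ¬ Hit Q v) ⊎ (∀ v → T (P v) → Hit Q v)
  ¬Hit-or-all Q? P with anySubset? (λ v → T? (P v) ×-dec ¬? (Hit? Q? v))
  ... | yes found = inj₁ found
  ... | no  none  = inj₂ λ v v∈P → decidable-stable (Hit? Q? v) λ ¬hit → none (v , v∈P , ¬hit)

  core-closed : ∀ N (P : Fam (N + M)) → Closed P → Uniform k P → TIntersecting t P → Large (cnt P) → Conclusion P
  core-closed N P closed uni int large with ¬Hit-or-all (Near? 0) P
  ... | inj₂ near = Near₀.block P uni near
  ... | inj₁ (K , K∈P , ¬near) = far-case (¬Hit-or-all (Near? 1) P)
    where
    far : ∀ e K → T (P K) → ¬ Hit (Near e) K → ∀ v → T (P v) → Hit (FarOrLow e) v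
    far e K K∈P ¬near v v∈P = meet⇒far-or-low e (≤-reflexive (uni K K∈P)) (≤-reflexive (uni v v∈P))
      (meet P P closed uni uni int K v K∈P v∈P) ¬near
    H = low N P
    uniH : Uniform k H
    uniH = low-uniform N P uni
    conclude : ∀ q {g} → cnt P ≡ cnt H + g →
      X * (s + suc q * j) * g + Y * s * cnt (shadow j H) ≤ Y * s * cnt (shadow j P) →
      s * τ * cnt H ≤ suc q * W * g → τ * cnt H ≤ g * suc (k + τ) → Conclusion P
    conclude q {g} size gain q-ineq f≤g = subst (λ z → X * z ≤ Y * cnt (shadow j P)) (sym size)
      (finish s a b q {cnt H} {g} {cnt (shadow j H)} {cnt (shadow j P)} {X} {Y} (rise-pos (s + τ) j) gain (low-LYM H uniH) q-ineq f≤g)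
    -- A member below the line of `Near 1` gives the surplus 2 j / s, so q = 1. Otherwise q = 0, and
    -- `low-count` applies to H.
    far-case : (∃ λ v → T (P v) × ¬ Hit (Near 1) v) ⊎ (∀ v → T (P v) → Hit (Near 1) v) → Conclusion P
    far-case (inj₁ (K₁ , K₁∈P , ¬near₁))
      with high-part 1 (X * (s + 2 * j)) (Y * s) Far₁.block N P uni (far 1 K₁ K₁∈P ¬near₁)
    ... | g , size , gain = conclude 1 size gain (double-gain s τ j {cnt H} {g} f≤g) f≤g
      where f≤g = τ*f≤g*K (cnt≤C H uniH) (subst Large size large)
    far-case (inj₂ near₁)
      with high-part 0 (X * (s + 1 * j)) (Y * s) Far₀.block N P uni (far 0 K K∈P ¬near)
    ... | g , size , gain = conclude 0 size gain
        (single-gain s a b {cnt H} {g} {u} {M C k} (low-count H uniH (low-near 1 N P uni near₁)) MCk (subst Large size large))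
        (τ*f≤g*K (cnt≤C H uniH) (subst Large size large))

  core : (P : Fam n) → Uniform k P → TIntersecting t P → Large (cnt P) → Conclusion P
  core {n} P uni int large with n ∸ M | m∸n+n≡m (M≤n P uni large)
  ... | N | refl with compress j P uni int
  ...   | Q , closed , uniQ , intQ , size , sh = begin
    X * cnt P              ≡⟨ cong (X *_) size ⟨
    X * cnt Q              ≤⟨ core-closed N Q closed uniQ intQ (subst Large (sym size) large) ⟩
    Y * cnt (shadow j Q)   ≤⟨ *-monoʳ-≤ Y sh ⟩
    Y * cnt (shadow j P)   ∎
    where open ≤-Reasoning

-- From repetition-free lists to Boolean families

_≟ˢ_ : DecidableEquality (Subset n)
_≟ˢ_ = ≡-dec Bool._≟_

fam : List (Subset n) → Fam n
fam Fs F = ⌊ member? _≟ˢ_ F Fs ⌋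

fam⁺ : (Fs : List (Subset n)) {F : Subset n} → F ∈ Fs → T (fam Fs F)
fam⁺ Fs {F} = fromWitness {a? = member? _≟ˢ_ F Fs}

fam⁻ : (Fs : List (Subset n)) {F : Subset n} → T (fam Fs F) → F ∈ Fs
fam⁻ Fs {F} = toWitness {a? = member? _≟ˢ_ F Fs}

-- `point` decides equality coordinate by coordinate, so that its sum splits along the head.
∑-point : (F : Subset n) → ∑ (λ G → 𝟙 ⌊ G ≟ˢ F ⌋) ≡ 1
∑-point F = trans (∑-cong λ G → cong 𝟙 (agree F G)) (go F)
  where
  point : Subset n → Fam n
  point [] [] = true
  point (b ∷ F) (c ∷ G) = ⌊ c Bool.≟ b ⌋ ∧ point F G
  agree : (F G : Subset n) → ⌊ G ≟ˢ F ⌋ ≡ point F G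
  agree [] [] = refl
  agree (b ∷ F) (c ∷ G) with c Bool.≟ b | agree F G
  ... | yes refl | e with G ≟ˢ F
  ...   | yes refl = e
  ...   | no _ = e
  agree (b ∷ F) (c ∷ G) | no _ | e = refl
  go : (F : Subset n) → ∑ (𝟙 ∘ point F) ≡ 1
  go [] = refl
  go {suc n} (inside ∷ F) = cong₂ _+_ (∑-zero {n} λ _ → refl) (go F)
  go {suc n} (outside ∷ F) = cong₂ _+_ (go F) (∑-zero {n} λ _ → refl)

cnt-fam : {Fs : List (Subset n)} → Unique Fs → cnt (fam Fs) ≡ length Fs
cnt-fam {n} []  = ∑-zero {n} λ _ → refl
cnt-fam {n} {F ∷ Fs} (F∉Fs ∷ uniq) = begin
  cnt (fam (F ∷ Fs))                                 ≡⟨ ∑-cong split ⟩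
  ∑ (λ G → 𝟙 ⌊ G ≟ˢ F ⌋ + 𝟙 (fam Fs G))              ≡⟨ ∑-+ (λ G → 𝟙 ⌊ G ≟ˢ F ⌋) (𝟙 ∘ fam Fs) ⟩
  ∑ (λ G → 𝟙 ⌊ G ≟ˢ F ⌋) + cnt (fam Fs)              ≡⟨ cong₂ _+_ (∑-point F) (cnt-fam uniq) ⟩
  suc (length Fs)                                    ∎
  where
  open ≡-Reasoning
  split : ∀ G → 𝟙 (fam (F ∷ Fs) G) ≡ 𝟙 ⌊ G ≟ˢ F ⌋ + 𝟙 (fam Fs G)
  split G with G ≟ˢ F | member? _≟ˢ_ G Fs
  ... | yes refl | yes G∈Fs = contradiction refl (All.lookup F∉Fs G∈Fs)
  ... | yes _    | no _  = refl
  ... | no _     | yes _ = refl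
  ... | no _     | no _  = refl

module _ {n k : ℕ} (𝓕 : Family n k) where

  fam-uniform : Uniform k (fam (members 𝓕))
  fam-uniform F F∈ = All.lookup (uniform 𝓕) (fam⁻ (members 𝓕) F∈)

  cnt-fam-shadow : ∀ j → j ≤ k → cnt (shadow j (fam (members 𝓕))) ≤ # (∂ j 𝓕)
  cnt-fam-shadow j j≤k = ≤-trans (cnt-mono in-∂) (≤-reflexive (cnt-fam (unique (∂ j 𝓕))))
    where
    in-∂ : ∀ G → T (shadow j (fam (members 𝓕)) G) → T (fam (members (∂ j 𝓕)) G)
    in-∂ G G∈ with shadow⁻ j (fam (members 𝓕)) G∈
    ... | F , F∈ , G⊆F , size = fam⁺ (members (∂ j 𝓕)) (∈-filter⁺ _ (∈-allSubsets G)
          (m+n≡o⇒m≡o∸n (trans size (fam-uniform F F∈)) , lose {P = G ⊆_} (fam⁻ (members 𝓕) F∈) G⊆F))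
      where
      m+n≡o⇒m≡o∸n : ∀ {m n o} → m + n ≡ o → m ≡ o ∸ n
      m+n≡o⇒m≡o∸n {m} {n} e = trans (sym (m+n∸n≡m m n)) (cong (_∸ n) e)

-- Turns X / Y back into a quotient of binomials: C(m, k - 1) X = C(m, k - 1 - j) Y by `C-rise`.
parametrized : ∀ s a b k t j → j ≡ suc b → t ≡ suc a + suc b → k ≡ suc (s + t) →
  (P : Fam n) → Uniform k P → TIntersecting t P →
  ((2 * k ∸ t) C k) * ((k + t + 1 ∸ j) + (t ∸ j)) ≤ cnt P * (k + t + 1 ∸ j) →
  ((2 * (k ∸ 1) ∸ t) C (k ∸ 1 ∸ j)) * cnt P ≤ cnt (shadow j P) * ((2 * (k ∸ 1) ∸ t) C (k ∸ 1))
parametrized s a b _ _ _ refl refl refl P uni int large =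
  subst₂ (λ x y → (x C y) * cnt P ≤ cnt (shadow j P) * (x C (s + t))) (sym 2[k-1]-t) (sym k-1-j)
    (*-cancelʳ-≤ _ _ Y {{>-nonZero (rise-pos s j)}} (begin
      (m C (s + τ)) * cnt P * Y                      ≡⟨ eq₁ (m C (s + τ)) (cnt P) Y ⟩
      (m C (s + τ)) * Y * cnt P                      ≡⟨ cong (_* cnt P) ratio ⟨
      (m C (s + t)) * X * cnt P                      ≡⟨ *-assoc (m C (s + t)) X _ ⟩
      (m C (s + t)) * (X * cnt P)                    ≤⟨ *-monoʳ-≤ (m C (s + t)) (core P uni int large′) ⟩
      (m C (s + t)) * (Y * cnt (shadow j P))         ≡⟨ eq₂ (m C (s + t)) Y (cnt (shadow j P)) ⟩
      cnt (shadow j P) * (m C (s + t)) * Y           ∎))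
  where
  open Core s a b
  open Parameters s τ j
  open ≤-Reasoning
  eq₁ : ∀ x y z → x * y * z ≡ x * z * y
  eq₁ = solve-∀
  eq₂ : ∀ x y z → x * (y * z) ≡ z * x * y
  eq₂ = solve-∀
  2k-t : 2 * k ∸ t ≡ M
  2k-t = trans (cong (_∸ t) (trans (cong (_+_ k) (+-identityʳ k)) k+k≡M+t)) (m+n∸n≡m M t)
  2[k-1]-t : 2 * (s + t) ∸ t ≡ m
  2[k-1]-t = trans (cong (_∸ t) (eq s t)) (m+n∸n≡m m t)
    where
    eq : ∀ s t → 2 * (s + t) ≡ s + t + s + t
    eq = solve-∀
  k-1-j : s + t ∸ j ≡ s + τ
  k-1-j = trans (cong (_∸ j) (sym (+-assoc s τ j))) (m+n∸n≡m (s + τ) j)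
  k+t+1-j : k + t + 1 ∸ j ≡ suc (k + τ)
  k+t+1-j = trans (cong (_∸ j) (eq k τ j)) (m+n∸n≡m (suc (k + τ)) j)
    where
    eq : ∀ k τ j → k + (τ + j) + 1 ≡ suc (k + τ) + j
    eq = solve-∀
  ratio : (m C (s + t)) * X ≡ (m C (s + τ)) * Y
  ratio = subst (λ x → ((x + s) C x) * X ≡ ((x + s) C (s + τ)) * Y) (+-assoc s τ j) (C-rise (s + τ) j s)
  large′ : Large (cnt P)
  large′ = subst₂ _≤_
    (cong₂ (λ x y → (x C k) * y) 2k-t (cong₂ _+_ k+t+1-j (m+n∸n≡m τ j)))
    (cong (cnt P *_) k+t+1-j) large

natural : ∀ k t j → k > t → t > j → j ≥ 1 → (P : Fam n) → Uniform k P → TIntersecting t P →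
  ((2 * k ∸ t) C k) * ((k + t + 1 ∸ j) + (t ∸ j)) ≤ cnt P * (k + t + 1 ∸ j) →
  ((2 * (k ∸ 1) ∸ t) C (k ∸ 1 ∸ j)) * cnt P ≤ cnt (shadow j P) * ((2 * (k ∸ 1) ∸ t) C (k ∸ 1))
natural k t (suc b) k>t t>j _ = parametrized (k ∸ suc t) (t ∸ suc (suc b)) b k t (suc b) refl
  (trans (sym (m∸n+n≡m t>j)) (+-suc (t ∸ suc (suc b)) (suc b)))
  (trans (sym (m∸n+n≡m k>t)) (+-suc (k ∸ suc t) t))

-- Passage between rational and natural inequalities

open import Data.Integer.Base using (+_)

toℚᵘ-/ : ∀ p q → toℚᵘ (+ p / suc q) ℚᵘ.≃ mkℚᵘ (+ p) q
toℚᵘ-/ p q = ℚ.toℚᵘ-fromℚᵘ (mkℚᵘ (+ p) q)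

-- In unnormalised rationals the numerators and denominators of sums and products are explicit, so
-- the order becomes an inequality of cross products.
large⇒ℕ : ∀ f c d e .{{_ : NonZero e}} → fromℕ f ℚ.≥ fromℕ c ℚ.* (1ℚ ℚ.+ + d / e) → c * (e + d) ≤ f * e
large⇒ℕ f c d (suc e) large with bound
  where
  open ℚᵘ.≤-Reasoning
  bound : mkℚᵘ (+ c) 0 ℚᵘ.* (1ℚᵘ ℚᵘ.+ mkℚᵘ (+ d) e) ℚᵘ.≤ mkℚᵘ (+ f) 0
  bound = begin
    mkℚᵘ (+ c) 0 ℚᵘ.* (1ℚᵘ ℚᵘ.+ mkℚᵘ (+ d) e)
      ≃⟨ ℚᵘ.*-cong (toℚᵘ-/ c 0) (ℚᵘ.≃-trans (ℚ.toℚᵘ-homo-+ 1ℚ (+ d / suc e)) (ℚᵘ.+-congʳ 1ℚᵘ (toℚᵘ-/ d e))) ⟨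
    toℚᵘ (fromℕ c) ℚᵘ.* toℚᵘ (1ℚ ℚ.+ + d / suc e)  ≃⟨ ℚ.toℚᵘ-homo-* (fromℕ c) (1ℚ ℚ.+ + d / suc e) ⟨
    toℚᵘ (fromℕ c ℚ.* (1ℚ ℚ.+ + d / suc e))        ≤⟨ ℚ.toℚᵘ-mono-≤ large ⟩
    toℚᵘ (fromℕ f)                                 ≃⟨ toℚᵘ-/ f 0 ⟩
    mkℚᵘ (+ f) 0                                   ∎
... | *≤* le = ℤ.drop‿+≤+ (subst₂ ℤ._≤_ lhs rhs le)
  where
  open ≡-Reasoning
  lhs : (+ c ℤ.* (ℤ.1ℤ ℤ.* + suc e ℤ.+ + d ℤ.* ℤ.1ℤ)) ℤ.* ℤ.1ℤ ≡ + (c * (suc e + d))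
  lhs = begin
    (+ c ℤ.* (ℤ.1ℤ ℤ.* + suc e ℤ.+ + d ℤ.* ℤ.1ℤ)) ℤ.* ℤ.1ℤ ≡⟨ ℤ.*-identityʳ _ ⟩
    + c ℤ.* (ℤ.1ℤ ℤ.* + suc e ℤ.+ + d ℤ.* ℤ.1ℤ) ≡⟨ cong₂ (λ x y → + c ℤ.* (x ℤ.+ y)) (ℤ.*-identityˡ (+ suc e)) (ℤ.*-identityʳ (+ d)) ⟩
    + c ℤ.* + (suc e + d)                       ≡⟨ ℤ.pos-* c (suc e + d) ⟨
    + (c * (suc e + d))                         ∎
  rhs : + f ℤ.* + suc (e + 0 + 0) ≡ + (f * suc e)
  rhs = trans (cong (λ x → + f ℤ.* + suc x) (trans (+-identityʳ (e + 0)) (+-identityʳ e))) (sym (ℤ.pos-* f (suc e)))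

ratio⇐ℕ : ∀ p q r s .{{_ : NonZero q}} .{{_ : NonZero s}} → r * q ≤ p * s → + p / q ℚ.≥ + r / s
ratio⇐ℕ p (suc q) r (suc s) le = ℚ.toℚᵘ-cancel-≤ (begin
  toℚᵘ (+ r / suc s) ≃⟨ toℚᵘ-/ r s ⟩
  mkℚᵘ (+ r) s       ≤⟨ *≤* (subst₂ ℤ._≤_ (ℤ.pos-* r (suc q)) (ℤ.pos-* p (suc s)) (ℤ.+≤+ le)) ⟩
  mkℚᵘ (+ p) q       ≃⟨ toℚᵘ-/ p q ⟨
  toℚᵘ (+ p / suc q) ∎)
  where open ℚᵘ.≤-Reasoning

theorem1p4 : (n k t j : ℕ) (n>k : n > k) (k>t : k > t) (t>j : t > j) (j≥1 : j ≥ 1)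
  (𝓕 : Family n k) → Intersecting t 𝓕 →
  let instance _ = k+t+1∸j-nonZero k t>j in
  (large : fromℕ (# 𝓕) ℚ.≥ fromℕ ((2 * k ∸ t) C k) ℚ.* (1ℚ ℚ.+ + (t ∸ j) / (k + t + 1 ∸ j))) →
  let instance
        _ = #-nonZero 𝓕 k>t t>j large
        _ = C-nonZero (k∸1≤2[k∸1]∸t k>t)
  in
  + (# (∂ j 𝓕)) / (# 𝓕) ℚ.≥ + ((2 * (k ∸ 1) ∸ t) C (k ∸ 1 ∸ j)) / ((2 * (k ∸ 1) ∸ t) C (k ∸ 1))
theorem1p4 n k t j n>k k>t t>j j≥1 𝓕 int large =
  ratio⇐ℕ (# (∂ j 𝓕)) (# 𝓕) c₁ c₂
    {{#-nonZero 𝓕 k>t t>j large}} {{C-nonZero (k∸1≤2[k∸1]∸t k>t)}} (begin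
    c₁ * # 𝓕                   ≡⟨ cong (c₁ *_) size ⟨
    c₁ * cnt P                 ≤⟨ natural k t j k>t t>j j≥1 P (fam-uniform 𝓕)
                                    (λ F G F∈ G∈ → int (fam⁻ (members 𝓕) F∈) (fam⁻ (members 𝓕) G∈)) large′ ⟩
    cnt (shadow j P) * c₂      ≤⟨ *-monoˡ-≤ c₂ (cnt-fam-shadow 𝓕 j (<⇒≤ (<-trans t>j k>t))) ⟩
    # (∂ j 𝓕) * c₂             ∎)
  where
  open ≤-Reasoning
  P = fam (members 𝓕)
  c₁ c₂ : ℕ
  c₁ = (2 * (k ∸ 1) ∸ t) C (k ∸ 1 ∸ j)
  c₂ = (2 * (k ∸ 1) ∸ t) C (k ∸ 1)
  size : cnt P ≡ # 𝓕
  size = cnt-fam (unique 𝓕)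
  large′ : ((2 * k ∸ t) C k) * ((k + t + 1 ∸ j) + (t ∸ j)) ≤ cnt P * (k + t + 1 ∸ j)
  large′ = subst (λ x → ((2 * k ∸ t) C k) * ((k + t + 1 ∸ j) + (t ∸ j)) ≤ x * (k + t + 1 ∸ j)) (sym size)
    (large⇒ℕ (# 𝓕) ((2 * k ∸ t) C k) (t ∸ j) (k + t + 1 ∸ j) {{k+t+1∸j-nonZero k t>j}} large)
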